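{- Let $x_1,x_2,y_1,y_2,u_1,u_2,v_1,v_2,w_{\rm e},w_{\rm o},z_{\rm e},z_{\rm o},p_{ -1},p_{ -2},p_{+1},p_{+2},q_{ -1},q_{ -2},q_{+1},q_{+2},s_{\rm e},s_{\rm o},\lambda$ be commuting indeterminates and for $n\ge0$ let \[ \widehat{P}_n=\sum_{\sigma\in\mathfrak{D}_{2n}}x_1^{\mathrm{eareccpeak}}x_2^{\mathrm{eareccdfall}}y_1^{\mathrm{ereccval}}y_2^{\mathrm{ereccdrise}}u_1^{\mathrm{nrcpeak}}u_2^{\mathrm{nrcdfall}}v_1^{\mathrm{nrcval}}v_2^{\mathrm{nrcdrise}}w_{\rm e}^{\mathrm{evennrfix}}w_{\rm o}^{\mathrm{oddnrfix}}z_{\rm e}^{\mathrm{evenrar}}z_{\rm o}^{\mathrm{oddrar}} p_{ -1}^{\mathrm{lcrosscpeak}}p_{ -2}^{\mathrm{lcrosscdfall}}p_{+1}^{\mathrm{ucrosscval}}p_{+2}^{\mathrm{ucrosscdrise}}q_{ -1}^{\mathrm{lnestcpeak}}q_{ -2}^{\mathrm{lnestcdfall}}q_{+1}^{\mathrm{unestcval}}q_{+2}^{\mathrm{unestcdrise}}s_{\rm e}^{\mathrm{epsnest}}s_{\rm o}^{\mathrm{opsnest}}\lambda^{\mathrm{cyc}}, \] all statistics evaluated at $\sigma$. Under the specialisation $v_1=y_1$ and $q_{+1}=p_{+1}$, \[ \sum_{n\ge0}\widehat{P}_n\,t^n=\cfrac{1}{1-\delta_1t-\cfrac{\alpha_1t}{1-\delta_2t-\cfrac{\alpha_2t}{1-\cdots}}}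 \] as formal power series in $t$, where for $k\ge1$: $\alpha_{2k-1}=(\lambda+k-1)\,p_{+1}^{k-1}y_1\big(p_{ -1}^{k-1}x_1+q_{ -1}[k-1]_{p_{ -1},q_{ -1}}u_1\big)$, $\alpha_{2k}=\big(p_{ -2}^{k-1}x_2+q_{ -2}[k-1]_{p_{ -2},q_{ -2}}u_2+\lambda s_{\rm e}^kw_{\rm e}\big)\big(p_{+2}^{k-1}y_2+q_{+2}[k-1]_{p_{+2},q_{+2}}v_2+\lambda s_{\rm o}^kw_{\rm o}\big)$, and $\delta_1=\lambda^2z_{\rm e}z_{\rm o}$, $\delta_n=0$ for $n\ge2$.
   Context: A D-permutation of $[2n]$ is a permutation with $\sigma(2k-1)\ge2k-1$ and $\sigma(2k)\le2k$ for all $k$; $\mathfrak{D}_{2n}$ is their set. For a permutation $\sigma$: index $i$ is a cycle peak if $\sigma^{ -1}(i)<i>\sigma(i)$, cycle valley if $\sigma^{ -1}(i)>i<\sigma(i)$, cycle double rise if $\sigma^{ -1}(i)<i<\sigma(i)$, cycle double fall if $\sigma^{ -1}(i)>i>\sigma(i)$, fixed point if $\sigma(i)=i$. Record: $\sigma(j)<\sigma(i)$ for all $j<i$; antirecord: $\sigma(j)>\sigma(i)$ for all $j>i$; exclusive record/antirecord = one but not the other; record-antirecord = both. $\mathrm{eareccpeak},\mathrm{eareccdfall}$ count cycle peaks, double falls that are exclusive antirecords; $\mathrm{ereccval},\mathrm{ereccdrise}$ count cycle valleys, double rises that are exclusive records; $\mathrm{nrcpeak},\mathrm{nrcdfall},\mathrm{nrcval},\mathrm{nrcdrise}$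 count cycle peaks, double falls, valleys, double rises that are neither records nor antirecords; $\mathrm{evennrfix}$ ($\mathrm{oddnrfix}$) counts even (odd) fixed points that are neither records nor antirecords; $\mathrm{evenrar}$ ($\mathrm{oddrar}$) counts even (odd) record-antirecords. $\mathrm{cyc}$ = number of cycles. $\mathrm{ucross}(j,\sigma)=\#\{(i,k,l):i<j<k<l,\ k=\sigma(i),\ l=\sigma(j)\}$, $\mathrm{unest}(j,\sigma)=\#\{(i,k,l):i<j<k<l,\ k=\sigma(j),\ l=\sigma(i)\}$, $\mathrm{lcross}(k,\sigma)=\#\{(i,j,l):i<j<k<l,\ i=\sigma(k),\ j=\sigma(l)\}$, $\mathrm{lnest}(k,\sigma)=\#\{(i,j,l):i<j<k<l,\ i=\sigma(l),\ j=\sigma(k)\}$. $\mathrm{ucrosscval}$ ($\mathrm{ucrosscdrise}$) is the sum of $\mathrm{ucross}(j,\sigma)$ over cycle valleys (cycle double rises) $j$, $\mathrm{unestcval},\mathrm{unestcdrise}$ likewise with $\mathrm{unest}$; $\mathrm{lcrosscpeak}$ ($\mathrm{lcrosscdfall}$) is the sum of $\mathrm{lcross}(k,\sigma)$ over cycle peaks (cycle double falls) $k$, $\mathrm{lnestcpeak},\mathrm{lnestcdfall}$ likewise with $\mathrm{lnest}$. For a fixed point $i$, $\mathrm{psnest}(i,\sigma)=\#\{j<i:\sigma(j)>i\}$; $\mathrm{epsnest}(\sigma)$ ($\mathrm{opsnest}(\sigma)$) is the sum of $\mathrm{psnest}(i,\sigma)$ over even (odd) fixed points $i$. $[m]_{p,q}=\sum_{j=0}^{m-1}p^{m-1-j}q^j$.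 -}

module Defs where

open import Level using (Level)
open import Data.Bool using (Bool; true; false; if_then_else_; _∧_; _∨_; not)
open import Data.Nat using (ℕ; zero; suc; ⌊_/2⌋; _∸_; _<ᵇ_; _≤ᵇ_; _≡ᵇ_)
open import Data.List using (List; []; _∷_; map; foldr; concatMap; upTo; filter; length; lookup)
open import Algebra.Bundles using (CommutativeRing)
import Data.Nat

-- Permutations of [m] are represented in one-line notation as lists
-- w = [σ(1), …, σ(m)] of natural numbers (1-based values).

rng : ℕ → List ℕ
rng m = map suc (upTo m)

insertions : ℕ → List ℕ → List (List ℕ)
insertions x [] = (x ∷ []) ∷ []
insertions x (y ∷ ys) = (x ∷ y ∷ ys) ∷ map (y ∷_) (insertions x ys)

perms : List ℕ → List (List ℕ)
perms [] = [] ∷ []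
perms (x ∷ xs) = concatMap (insertions x) (perms xs)

-- i-th entry (1-based), 0 if out of range
at : List ℕ → ℕ → ℕ
at [] _ = 0
at (x ∷ xs) zero = 0
at (x ∷ xs) (suc zero) = x
at (x ∷ xs) (suc (suc i)) = at xs (suc i)

allL : List ℕ → (ℕ → Bool) → Bool
allL xs P = foldr (λ a b → P a ∧ b) true xs

anyL : List ℕ → (ℕ → Bool) → Bool
anyL xs P = foldr (λ a b → P a ∨ b) false xs

countL : List ℕ → (ℕ → Bool) → ℕ
countL xs P = foldr (λ a b → if P a then suc b else b) 0 xs

isEven : ℕ → Bool
isEven zero = true
isEven (suc n) = not (isEven n)

isOdd : ℕ → Bool
isOdd n = not (isEven n)

-- σ⁻¹(i): the j ∈ [m] with σ(j) = i (0 if none)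
inv : List ℕ → ℕ → ℕ
inv w i = foldr (λ j r → if at w j ≡ᵇ i then j else r) 0 (rng (length w))

isD : List ℕ → Bool
isD w = allL (rng (length w))
  (λ i → if isEven i then at w i ≤ᵇ i else i ≤ᵇ at w i)

Dperms : ℕ → List (List ℕ)
Dperms n = filter (λ w → isD w Data.Bool.≟ true) (perms (rng (n Data.Nat.+ n)))
  where import Data.Bool

module Stats (w : List ℕ) where
  m : ℕ
  m = length w

  σ : ℕ → ℕ
  σ = at w

  σ⁻¹ : ℕ → ℕ
  σ⁻¹ = inv w

  cnt : (ℕ → Bool) → ℕ
  cnt = countL (rng m)

  cpeak cval cdrise cdfall fix : ℕ → Bool
  cpeak  i = (σ⁻¹ i <ᵇ i) ∧ (σ i <ᵇ i)
  cval   i = (i <ᵇ σ⁻¹ i) ∧ (i <ᵇ σ i)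
  cdrise i = (σ⁻¹ i <ᵇ i) ∧ (i <ᵇ σ i)
  cdfall i = (i <ᵇ σ⁻¹ i) ∧ (σ i <ᵇ i)
  fix    i = σ i ≡ᵇ i

  rec arec : ℕ → Bool
  rec  i = allL (rng m) (λ j → if j <ᵇ i then σ j <ᵇ σ i else true)
  arec i = allL (rng m) (λ j → if i <ᵇ j then σ i <ᵇ σ j else true)

  erec earec rar nr : ℕ → Bool
  erec  i = rec i ∧ not (arec i)
  earec i = arec i ∧ not (rec i)
  rar   i = rec i ∧ arec i
  nr    i = not (rec i) ∧ not (arec i)

  eareccpeak eareccdfall ereccval ereccdrise : ℕ
  eareccpeak  = cnt (λ i → cpeak i ∧ earec i)
  eareccdfall = cnt (λ i → cdfall i ∧ earec i)
  ereccval    = cnt (λ i → cval i ∧ erec i)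
  ereccdrise  = cnt (λ i → cdrise i ∧ erec i)

  nrcpeak nrcdfall nrcval nrcdrise : ℕ
  nrcpeak  = cnt (λ i → cpeak i ∧ nr i)
  nrcdfall = cnt (λ i → cdfall i ∧ nr i)
  nrcval   = cnt (λ i → cval i ∧ nr i)
  nrcdrise = cnt (λ i → cdrise i ∧ nr i)

  evennrfix oddnrfix evenrar oddrar : ℕ
  evennrfix = cnt (λ i → fix i ∧ nr i ∧ isEven i)
  oddnrfix  = cnt (λ i → fix i ∧ nr i ∧ isOdd i)
  evenrar   = cnt (λ i → rar i ∧ isEven i)
  oddrar    = cnt (λ i → rar i ∧ isOdd i)

  -- ucross(j) = #{(i,k,l) : i<j<k<l, k=σ(i), l=σ(j)}
  ucross : ℕ → ℕ
  ucross j = cnt (λ i → (i <ᵇ j) ∧ (j <ᵇ σ i) ∧ (σ i <ᵇ σ j))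
  -- unest(j) = #{(i,k,l) : i<j<k<l, k=σ(j), l=σ(i)}
  unest : ℕ → ℕ
  unest j = cnt (λ i → (i <ᵇ j) ∧ (j <ᵇ σ j) ∧ (σ j <ᵇ σ i))
  -- lcross(k) = #{(i,j,l) : i<j<k<l, i=σ(k), j=σ(l)}
  lcross : ℕ → ℕ
  lcross k = cnt (λ l → (k <ᵇ l) ∧ (σ k <ᵇ σ l) ∧ (σ l <ᵇ k))
  -- lnest(k) = #{(i,j,l) : i<j<k<l, i=σ(l), j=σ(k)}
  lnest : ℕ → ℕ
  lnest k = cnt (λ l → (k <ᵇ l) ∧ (σ l <ᵇ σ k) ∧ (σ k <ᵇ k))
  psnest : ℕ → ℕ
  psnest i = cnt (λ j → (j <ᵇ i) ∧ (i <ᵇ σ j))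

  sumOver : (ℕ → Bool) → (ℕ → ℕ) → ℕ
  sumOver P f = foldr (λ a b → if P a then f a Data.Nat.+ b else b) 0 (rng m)

  ucrosscval ucrosscdrise unestcval unestcdrise : ℕ
  ucrosscval   = sumOver cval ucross
  ucrosscdrise = sumOver cdrise ucross
  unestcval    = sumOver cval unest
  unestcdrise  = sumOver cdrise unest

  lcrosscpeak lcrosscdfall lnestcpeak lnestcdfall : ℕ
  lcrosscpeak  = sumOver cpeak lcross
  lcrosscdfall = sumOver cdfall lcross
  lnestcpeak   = sumOver cpeak lnest
  lnestcdfall  = sumOver cdfall lnest

  epsnest opsnest : ℕ
  epsnest = sumOver (λ i → fix i ∧ isEven i) psnest
  opsnest = sumOver (λ i → fix i ∧ isOdd i) psnest

  iter : ℕ → ℕ → ℕ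
  iter zero i = i
  iter (suc k) i = σ (iter k i)

  -- number of cycles = number of i ∈ [m] that are the smallest element of their cycle
  cyc : ℕ
  cyc = cnt (λ i → allL (rng m) (λ k → i ≤ᵇ iter k i))

module WithRing {c ℓ : Level} (R : CommutativeRing c ℓ) where
  open CommutativeRing R

  pow : Carrier → ℕ → Carrier
  pow x zero = 1#
  pow x (suc n) = x * pow x n

  nat : ℕ → Carrier
  nat zero = 0#
  nat (suc n) = 1# + nat n

  sumR : List Carrier → Carrier
  sumR = foldr _+_ 0#

  qint : ℕ → Carrier → Carrier → Carrier
  qint m p q = sumR (map (λ j → pow p (m ∸ suc j) * pow q j) (upTo m))

  record Params : Set c where
    field
      x₁ x₂ y₁ y₂ u₁ u₂ v₁ v₂ wₑ wₒ zₑ zₒ : Carrier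
      p₋₁ p₋₂ p₊₁ p₊₂ q₋₁ q₋₂ q₊₁ q₊₂ sₑ sₒ λ' : Carrier

  module _ (P : Params) where
    open Params P

    weight : List ℕ → Carrier
    weight w =
      pow x₁ eareccpeak * pow x₂ eareccdfall * pow y₁ ereccval * pow y₂ ereccdrise *
      pow u₁ nrcpeak * pow u₂ nrcdfall * pow v₁ nrcval * pow v₂ nrcdrise *
      pow wₑ evennrfix * pow wₒ oddnrfix * pow zₑ evenrar * pow zₒ oddrar *
      pow p₋₁ lcrosscpeak * pow p₋₂ lcrosscdfall * pow p₊₁ ucrosscval * pow p₊₂ ucrosscdrise *
      pow q₋₁ lnestcpeak * pow q₋₂ lnestcdfall * pow q₊₁ unestcval * pow q₊₂ unestcdrise *
      pow sₑ epsnest * pow sₒ opsnest * pow λ' cyc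
      where open Stats w

    Phat : ℕ → Carrier
    Phat n = sumR (map weight (Dperms n))

    αodd αeven : ℕ → Carrier
    αodd k = (λ' + nat (k ∸ 1)) * pow p₊₁ (k ∸ 1) * y₁ *
             (pow p₋₁ (k ∸ 1) * x₁ + q₋₁ * qint (k ∸ 1) p₋₁ q₋₁ * u₁)
    αeven k = (pow p₋₂ (k ∸ 1) * x₂ + q₋₂ * qint (k ∸ 1) p₋₂ q₋₂ * u₂ + λ' * pow sₑ k * wₑ) *
              (pow p₊₂ (k ∸ 1) * y₂ + q₊₂ * qint (k ∸ 1) p₊₂ q₊₂ * v₂ + λ' * pow sₒ k * wₒ)

    -- α_n for n ≥ 1 (α_0 unused)
    α : ℕ → Carrier
    α zero = 0#
    α (suc j) = if isEven j then αodd (suc ⌊ j /2⌋) else αeven (suc ⌊ j /2⌋)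

    δ : ℕ → Carrier
    δ (suc zero) = λ' * λ' * zₑ * zₒ
    δ _ = 0#

  Series : Set c
  Series = ℕ → Carrier

  oneS : Series
  oneS zero = 1#
  oneS (suc _) = 0#

  _+S_ : Series → Series → Series
  (f +S g) n = f n + g n

  scale : Carrier → Series → Series
  scale a f n = a * f n

  _*S_ : Series → Series → Series
  (f *S g) n = sumR (map (λ i → f i * g (n ∸ i)) (upTo (suc n)))

  shiftT : Series → Series
  shiftT f zero = 0#
  shiftT f (suc n) = f n

  powS : Series → ℕ → Series
  powS f zero = oneS
  powS f (suc k) = f *S powS f k

  -- 1 / (1 - t·a) = Σ_{k≥0} (t a)^k ; coefficient n only needs k ≤ n
  invOneMinusT : Series → Series
  invOneMinusT a n = sumR (map (λ k → powS (shiftT a) k n) (upTo (suc n)))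

  -- depth-d truncation of the J-fraction starting at level ℓv:
  --   frac 0 ℓv = 1
  --   frac (d+1) ℓv = 1 / (1 - δ_{ℓv+1} t - α_{ℓv+1} t · frac d (ℓv+1))
  frac : Params → ℕ → ℕ → Series
  frac P zero lv = oneS
  frac P (suc d) lv =
    invOneMinusT (scale (δ P (suc lv)) oneS +S scale (α P (suc lv)) (frac P d (suc lv)))

{-# OPTIONS --safe #-}
module Submission where

-- Read the one-line notation from right to left.  At position i, the suffix u = σ(i) … σ(m) is described
-- by the set T of its values below i and the set S of the values ≥ i that it lacks; |S| = |T| = h is the
-- height of a Motzkin-like path.  Every statistic at i depends only on the rank of σ(i) in T (if σ(i) < i)
-- or in S (if σ(i) > i), so summing over the choices of σ(i) gives the factors p^(h-1) x + q [h-1] y.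
-- Following the edges j ↦ σ(j), j ≥ i, from S ends in T and defines a bijection S → T; hence, when i is a
-- cycle valley, exactly one of the h + 1 choices of σ(i) closes a cycle, and it makes i the minimum of that
-- cycle.  As the other weights of a valley do not depend on the choice when v₁ = y₁ and q₊₁ = p₊₁, the
-- valleys contribute λ + h.  The weighted paths are then counted by the continued fraction.

open import Defs
open import Level using (Level)
open import Data.Nat using (ℕ; zero; suc; _+_; _∸_; _≤_; _<_; _>_; _≡ᵇ_; _≤ᵇ_; _<ᵇ_; z≤n; s≤s; ⌊_/2⌋)
open import Algebra.Bundles using (CommutativeRing)
open import Data.Bool using (Bool; true; false; if_then_else_; not; _∧_)
import Data.Bool
open import Data.Bool.Properties using (∧-zeroʳ)
open import Data.Fin using (Fin; toℕ; fromℕ<)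
open import Data.Fin.Properties using (toℕ<n; fromℕ<-injective; pigeonhole)
open import Data.List using (List; []; _∷_; _++_; map; length; concatMap; applyUpTo; foldr)
open import Data.List.Membership.Propositional using (_∈_; _∉_; find; lose)
open import Data.List.Membership.Propositional.Properties
  using (∈-++⁻; ∈-++⁺ˡ; ∈-++⁺ʳ; ∈-∃++; ∈-map⁺; ∈-map⁻; ∈-concatMap⁻; ∈-concatMap⁺; ∈-filter⁻; ∈-filter⁺)
open import Data.List.Membership.Propositional.Properties.WithK using (unique∧set⇒bag)
open import Data.List.Properties
  using (map-++; length-++; ++-assoc; ++-identityʳ; ∷-injectiveˡ; ∷-injectiveʳ; map-upTo; map-∘)
open import Data.List.Relation.Binary.BagAndSetEquality using (∼bag⇒↭)
open import Data.List.Relation.Binary.Permutation.Propositional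
  using (_↭_; ↭-refl; ↭-sym; ↭-trans; ↭⇒↭ₛ; prep; swap; module PermutationReasoning)
open import Data.List.Relation.Binary.Permutation.Propositional.Properties
  using (shift; drop-∷; ++⁺ˡ; ++⁺ʳ; map⁺; ∈-resp-↭; All-resp-↭; ↭-length; ↭-empty-inv)
import Data.List.Relation.Binary.Permutation.Setoid.Properties as PermSetoid
open import Data.List.Relation.Unary.All using (All; []; _∷_)
import Data.List.Relation.Unary.All as All
import Data.List.Relation.Unary.All.Properties as AllP
open import Data.List.Relation.Unary.AllPairs using (AllPairs; []; _∷_)
import Data.List.Relation.Unary.AllPairs as AP
import Data.List.Relation.Unary.AllPairs.Properties as APP
open import Data.List.Relation.Unary.Any using (here; there)
open import Data.List.Relation.Unary.Unique.Propositional using (Unique)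
import Data.List.Relation.Unary.Unique.Propositional.Properties as UP
open import Data.Nat.Induction using (<-rec)
open import Data.Nat.Properties
open import Data.Product using (∃; _×_; _,_; proj₁; proj₂)
open import Data.Sum using (_⊎_; inj₁; inj₂)
open import Function using (mk⇔; _on_)
open import Relation.Binary.Definitions using (tri<; tri≈; tri>)
open import Relation.Binary.PropositionalEquality
import Relation.Binary.Reasoning.Setoid as SetoidReasoning
open import Relation.Nullary using (yes; no; contradiction)

-- Why a single δ occurs: assign the doubled height 2h to a moment before an odd position and 2h - 1
-- to one before an even position. A valley becomes an up step from 2h to 2h + 1, a double rise or
-- odd fixed point a down step from 2h to 2h - 1, a double fall or even fixed point an up step from
-- 2h - 1 to 2h, and a peak a down step from 2h - 1 to 2h - 2. Every step is now up or down, so the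
-- paths are Dyck paths: α of index j is the weight of the rise to doubled height j times that of
-- the fall from it. The exception is at 0, where two fixed points lead to -1 and back at once; this
-- pair of steps is δ₁. One power of t marks two positions. The lists `T` and `S` play different
-- roles. `T` is handed on from left to right and is known before the suffix is chosen; `S` is
-- produced by the suffix. Falls therefore choose σ(i) before the rest of the word is generated,
-- rises afterwards. Reading from the right also makes a cycle close exactly at its minimum, once
-- all its other positions have been read.

iota : ℕ → ℕ → List ℕ
iota s zero = []
iota s (suc r) = s ∷ iota (suc s) r

-- Suffix e r i T S u: the word u occupies the positions i, …, i + r − 1, e is the parity of i, and T and S
-- are as above.  In the constructors, b and c are the elements listed before and after a = σ(i) in T or S.
data Suffix : Bool → ℕ → ℕ → List ℕ → List ℕ → List ℕ → Set where
  done : ∀ {e i} → Suffix e 0 i [] [] []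
  fixed : ∀ {e r i T S u} →
    Suffix (not e) r (suc i) T S u → Suffix e (suc r) i T S (i ∷ u)
  peak : ∀ {r i S u} b a c →
    Suffix false r (suc i) (b ++ c) S u → Suffix true (suc r) i (b ++ a ∷ c) (i ∷ S) (a ∷ u)
  dfall : ∀ {r i S u} b a c →
    Suffix false r (suc i) (i ∷ b ++ c) S u → Suffix true (suc r) i (b ++ a ∷ c) S (a ∷ u)
  drise : ∀ {r i T u} b a c →
    Suffix true r (suc i) T (b ++ a ∷ c) u → Suffix false (suc r) i T (i ∷ b ++ c) (a ∷ u)
  valley : ∀ {r i T u} b a c →
    Suffix true r (suc i) (i ∷ T) (b ++ a ∷ c) u → Suffix false (suc r) i T (b ++ c) (a ∷ u)

pull : ∀ {A : Set} (b : List A) a c → b ++ a ∷ c ↭ a ∷ b ++ c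
pull b a c = shift a b c

-- The set identity behind `T` and `S`: the values of `u` are those in `T` together with the values
-- from `i` on that are not in `S`. Equality of the two heights, membership tests and the transfer
-- of counts all come from it.
suffix-↭ : ∀ {e r i T S u} → Suffix e r i T S u → u ++ S ↭ T ++ iota i r
suffix-↭ done = ↭-refl
suffix-↭ (fixed {r = r} {i} {T} {S} {u} d) = begin
  i ∷ u ++ S               ↭⟨ prep _ (suffix-↭ d) ⟩
  i ∷ T ++ iota (suc i) r  ↭⟨ pull T i _ ⟨
  T ++ iota i (suc r)      ∎
  where open PermutationReasoning
suffix-↭ (peak {r} {i} {S} {u} b a c d) = begin
  a ∷ u ++ i ∷ S                      ↭⟨ prep _ (pull u i S) ⟩
  a ∷ i ∷ u ++ S                      ↭⟨ swap _ _ ↭-refl ⟩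
  i ∷ a ∷ u ++ S                      ↭⟨ prep _ (prep a (suffix-↭ d)) ⟩
  i ∷ (a ∷ b ++ c) ++ iota (suc i) r  ↭⟨ prep _ (++⁺ʳ _ (pull b a c)) ⟨
  i ∷ (b ++ a ∷ c) ++ iota (suc i) r  ↭⟨ pull (b ++ a ∷ c) i _ ⟨
  (b ++ a ∷ c) ++ iota i (suc r)      ∎
  where open PermutationReasoning
suffix-↭ (dfall {r} {i} {S} {u} b a c d) = begin
  a ∷ u ++ S                          ↭⟨ prep _ (suffix-↭ d) ⟩
  a ∷ i ∷ (b ++ c) ++ iota (suc i) r  ↭⟨ swap _ _ ↭-refl ⟩
  i ∷ (a ∷ b ++ c) ++ iota (suc i) r  ↭⟨ prep _ (++⁺ʳ _ (pull b a c)) ⟨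
  i ∷ (b ++ a ∷ c) ++ iota (suc i) r  ↭⟨ pull (b ++ a ∷ c) i _ ⟨
  (b ++ a ∷ c) ++ iota i (suc r)      ∎
  where open PermutationReasoning
suffix-↭ (drise {r} {i} {T} {u} b a c d) = begin
  a ∷ u ++ i ∷ b ++ c      ↭⟨ prep _ (pull u i (b ++ c)) ⟩
  a ∷ i ∷ u ++ b ++ c      ↭⟨ swap _ _ ↭-refl ⟩
  i ∷ a ∷ u ++ b ++ c      ↭⟨ prep _ (pull u a (b ++ c)) ⟨
  i ∷ u ++ a ∷ b ++ c      ↭⟨ prep _ (++⁺ˡ u (pull b a c)) ⟨
  i ∷ u ++ b ++ a ∷ c      ↭⟨ prep _ (suffix-↭ d) ⟩
  i ∷ T ++ iota (suc i) r  ↭⟨ pull T i _ ⟨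
  T ++ iota i (suc r)      ∎
  where open PermutationReasoning
suffix-↭ (valley {r} {i} {T} {u} b a c d) = begin
  a ∷ u ++ b ++ c          ↭⟨ pull u a (b ++ c) ⟨
  u ++ a ∷ b ++ c          ↭⟨ ++⁺ˡ u (pull b a c) ⟨
  u ++ b ++ a ∷ c          ↭⟨ suffix-↭ d ⟩
  i ∷ T ++ iota (suc i) r  ↭⟨ pull T i _ ⟨
  T ++ iota i (suc r)      ∎
  where open PermutationReasoning

length-word : ∀ {e r i T S u} → Suffix e r i T S u → length u ≡ r
length-word done = refl
length-word (fixed d) = cong suc (length-word d)
length-word (peak b a c d) = cong suc (length-word d)
length-word (dfall b a c d) = cong suc (length-word d)
length-word (drise b a c d) = cong suc (length-word d)
length-word (valley b a c d) = cong suc (length-word d)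

length-iota : ∀ s r → length (iota s r) ≡ r
length-iota s zero = refl
length-iota s (suc r) = cong suc (length-iota (suc s) r)

length-S≡T : ∀ {e r i T S u} → Suffix e r i T S u → length S ≡ length T
length-S≡T {r = r} {i} {T} {S} {u} d = +-cancelˡ-≡ r _ _ (begin
  r + length S                 ≡⟨ cong (_+ length S) (length-word d) ⟨
  length u + length S          ≡⟨ length-++ u ⟨
  length (u ++ S)              ≡⟨ ↭-length (suffix-↭ d) ⟩
  length (T ++ iota i r)       ≡⟨ length-++ T ⟩
  length T + length (iota i r) ≡⟨ cong (length T +_) (length-iota i r) ⟩
  length T + r                 ≡⟨ +-comm (length T) r ⟩
  r + length T                 ∎)
  where open ≡-Reasoning

-- Order of the two lists

module _ {ℓ} {R : ℕ → ℕ → Set ℓ} where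
  AllPairs-mid⁻ : ∀ b {a c} → AllPairs R (b ++ a ∷ c) →
    All (λ x → R x a) b × All (R a) c × AllPairs R (b ++ c)
  AllPairs-mid⁻ [] (p ∷ ps) = [] , p , ps
  AllPairs-mid⁻ (x ∷ b) (p ∷ ps) with AllPairs-mid⁻ b ps | AllP.++⁻ b p
  ... | q , q′ , q″ | p₁ , p₂ ∷ p₃ = p₂ ∷ q , q′ , AllP.++⁺ p₁ p₃ ∷ q″

All-mid⁻ : ∀ {ℓ} {P : ℕ → Set ℓ} b {a c} → All P (b ++ a ∷ c) → P a × All P (b ++ c)
All-mid⁻ b ps with AllP.++⁻ b ps
... | p₁ , p₂ ∷ p₃ = p₂ , AllP.++⁺ p₁ p₃

-- T is listed decreasingly and S increasingly.
Below : ℕ → List ℕ → Set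
Below i T = All (_< i) T × AllPairs _>_ T

Above : ℕ → List ℕ → Set
Above i S = All (i ≤_) S × AllPairs _<_ S

below-∷ : ∀ {i T} → Below i T → Below (suc i) (i ∷ T)
below-∷ (lt , desc) = n<1+n _ ∷ All.map m<n⇒m<1+n lt , lt ∷ desc

below-suc : ∀ {i T} → Below i T → Below (suc i) T
below-suc (lt , desc) = All.map m<n⇒m<1+n lt , desc

below-drop : ∀ {i} b {a c} → Below i (b ++ a ∷ c) → Below i (b ++ c)
below-drop b (lt , desc) = proj₂ (All-mid⁻ b lt) , proj₂ (proj₂ (AllPairs-mid⁻ b desc))

above-drop : ∀ {i} b {a c} → Above i (b ++ a ∷ c) → Above i (b ++ c)
above-drop b (lt , desc) = proj₂ (All-mid⁻ b lt) , proj₂ (proj₂ (AllPairs-mid⁻ b desc))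

above-pred : ∀ {i S} → Above (suc i) S → Above i S
above-pred (ge , asc) = All.map <⇒≤ ge , asc

above-∷ : ∀ {i S} → Above (suc i) S → Above i (i ∷ S)
above-∷ (ge , asc) = ≤-refl ∷ All.map <⇒≤ ge , ge ∷ asc

-- Read from the right, `S` starts empty and only receives a new least element in front or loses an
-- element, so its order is automatic. In `T` a value may be inserted anywhere; its order has to be
-- assumed, as `Below`, and passed on to the right.
suffix-above : ∀ {e r i T S u} → Suffix e r i T S u → Above i S
suffix-above done = [] , []
suffix-above (fixed d) = above-pred (suffix-above d)
suffix-above (peak b a c d) = above-∷ (suffix-above d)
suffix-above (dfall b a c d) = above-pred (suffix-above d)
suffix-above (drise b a c d) = above-∷ (above-drop b (suffix-above d))
suffix-above (valley b a c d) = above-pred (above-drop b (suffix-above d))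

-- Endpoints of the paths inside a suffix

≡ᵇ-true : ∀ {m n} → m ≡ n → (m ≡ᵇ n) ≡ true
≡ᵇ-true {zero} refl = refl
≡ᵇ-true {suc m} refl = ≡ᵇ-true {m} refl

≡ᵇ-false : ∀ {m n} → m ≢ n → (m ≡ᵇ n) ≡ false
≡ᵇ-false {zero} {zero} ne = contradiction refl ne
≡ᵇ-false {zero} {suc n} ne = refl
≡ᵇ-false {suc m} {zero} ne = refl
≡ᵇ-false {suc m} {suc n} ne = ≡ᵇ-false {m} {n} (λ p → ne (cong suc p))

-- Endpoint of the path v, σ(v), σ²(v), … in the graph whose edges leave the
-- positions i, i+1, … of the word u.
follow : ℕ → List ℕ → ℕ → ℕ
follow i [] v = v
follow i (a ∷ u) v =
  if follow (suc i) u v ≡ᵇ i then follow (suc i) u a else follow (suc i) u v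

follow-low : ∀ i u {v} → v < i → follow i u v ≡ v
follow-low i [] lt = refl
follow-low i (a ∷ u) lt
  rewrite follow-low (suc i) u (m<n⇒m<1+n lt) | ≡ᵇ-false (<⇒≢ lt) = refl

replace : ℕ → ℕ → ℕ → ℕ
replace i x y = if y ≡ᵇ i then x else y

replace-id : ∀ {i x} ys → All (_≢ i) ys → map (replace i x) ys ≡ ys
replace-id [] [] = refl
replace-id (y ∷ ys) (p ∷ ps) rewrite ≡ᵇ-false p = cong (y ∷_) (replace-id ys ps)

map-follow-∷ : ∀ i a u S → map (follow i (a ∷ u)) S ≡ map (replace i (follow (suc i) u a)) (map (follow (suc i) u) S)
map-follow-∷ i a u [] = refl
map-follow-∷ i a u (s ∷ S) = cong (_ ∷_) (map-follow-∷ i a u S)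

All-<⇒≢ : ∀ {i T} → All (_< i) T → All (_≢ i) T
All-<⇒≢ = All.map <⇒≢

-- Reading position `i` adds the single edge from `i` to `a`: the path that used to stop at `i`, if
-- there is one, now continues to the end of the path from `a`, and all others stay as they were.
-- Each case compares this redirection with the change of `T` and `S`.
follow-↭ : ∀ {e r i T S u} → Suffix e r i T S u → All (_< i) T → map (follow i u) S ↭ T
follow-↭ done _ = ↭-refl
follow-↭ (fixed {i = i} {T} {S} {u} d) lt
  rewrite map-follow-∷ i i u S = begin
  map (replace i _) (map (follow (suc i) u) S) ↭⟨ map⁺ _ (follow-↭ d (All.map m<n⇒m<1+n lt)) ⟩
  map (replace i _) T                          ≡⟨ replace-id T (All-<⇒≢ lt) ⟩
  T                                            ∎
  where open PermutationReasoning
follow-↭ (peak {r} {i} {S} {u} b a c d) lt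
  rewrite map-follow-∷ i a u S | follow-low (suc i) u (n<1+n i) | ≡ᵇ-true {i} refl
        | follow-low (suc i) u (m<n⇒m<1+n (proj₁ (All-mid⁻ b lt))) = begin
  a ∷ map (replace i a) (map (follow (suc i) u) S) ↭⟨ prep _ (map⁺ _ (follow-↭ d (All.map m<n⇒m<1+n lt′))) ⟩
  a ∷ map (replace i a) (b ++ c)                   ≡⟨ cong (a ∷_) (replace-id (b ++ c) (All-<⇒≢ lt′)) ⟩
  a ∷ b ++ c                                       ↭⟨ pull b a c ⟨
  b ++ a ∷ c                                       ∎
  where
  open PermutationReasoning
  lt′ : All (_< i) (b ++ c)
  lt′ = proj₂ (All-mid⁻ b lt)
follow-↭ (dfall {r} {i} {S} {u} b a c d) lt
  rewrite map-follow-∷ i a u S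
        | follow-low (suc i) u (m<n⇒m<1+n (proj₁ (All-mid⁻ b lt))) = begin
  map (replace i a) (map (follow (suc i) u) S) ↭⟨ map⁺ _ (follow-↭ d (n<1+n i ∷ All.map m<n⇒m<1+n lt′)) ⟩
  replace i a i ∷ map (replace i a) (b ++ c)   ≡⟨ cong₂ _∷_ (cong (if_then a else i) (≡ᵇ-true {i} refl)) (replace-id (b ++ c) (All-<⇒≢ lt′)) ⟩
  a ∷ b ++ c                                   ↭⟨ pull b a c ⟨
  b ++ a ∷ c                                   ∎
  where
  open PermutationReasoning
  lt′ : All (_< i) (b ++ c)
  lt′ = proj₂ (All-mid⁻ b lt)
follow-↭ (drise {r} {i} {T} {u} b a c d) lt
  rewrite map-follow-∷ i a u (b ++ c) | follow-low (suc i) u (n<1+n i) | ≡ᵇ-true {i} refl = begin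
  φ a ∷ map (replace i (φ a)) (map φ (b ++ c)) ≡⟨ cong (φ a ∷_) (replace-id _ (All-<⇒≢ (All.tail all))) ⟩
  φ a ∷ map φ (b ++ c)                         ↭⟨ map⁺ φ (pull b a c) ⟨
  map φ (b ++ a ∷ c)                           ↭⟨ IH ⟩
  T                                            ∎
  where
  open PermutationReasoning
  φ : ℕ → ℕ
  φ = follow (suc i) u
  IH : map φ (b ++ a ∷ c) ↭ T
  IH = follow-↭ d (All.map m<n⇒m<1+n lt)
  all : All (_< i) (φ a ∷ map φ (b ++ c))
  all = All-resp-↭ (↭-trans (↭-sym IH) (map⁺ φ (pull b a c))) lt
follow-↭ (valley {r} {i} {T} {u} b a c d) lt
  rewrite map-follow-∷ i a u (b ++ c) = go (φ a ≟ i)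
  where
  open PermutationReasoning
  φ : ℕ → ℕ
  φ = follow (suc i) u
  IH : φ a ∷ map φ (b ++ c) ↭ i ∷ T
  IH = ↭-trans (↭-sym (map⁺ φ (pull b a c))) (follow-↭ d (n<1+n i ∷ All.map m<n⇒m<1+n lt))
  replaced : replace i (φ a) (φ a) ≡ φ a
  replaced with φ a ≡ᵇ i
  ... | true = refl
  ... | false = refl
  go : _ → map (replace i (φ a)) (map φ (b ++ c)) ↭ T
  -- The new edge closes a cycle: `i` is the endpoint of `a` alone, and the other paths are
  -- unchanged.
  go (yes φa≡i) = begin
    map (replace i (φ a)) (map φ (b ++ c)) ≡⟨ replace-id _ (All-<⇒≢ (All-resp-↭ (↭-sym IH′) lt)) ⟩
    map φ (b ++ c)                         ↭⟨ IH′ ⟩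
    T                                      ∎
    where
    IH′ : map φ (b ++ c) ↭ T
    IH′ = drop-∷ (subst (λ x → x ∷ map φ (b ++ c) ↭ i ∷ T) φa≡i IH)
  -- With `φ a` added on both sides, the replacement can be applied to the whole of `IH`: it fixes
  -- `φ a` and turns `i` into `φ a`, which then cancels.
  go (no _) = drop-∷ (begin
    φ a ∷ map (replace i (φ a)) (map φ (b ++ c))                         ≡⟨ cong (_∷ map (replace i (φ a)) (map φ (b ++ c))) replaced ⟨
    map (replace i (φ a)) (φ a ∷ map φ (b ++ c))                         ↭⟨ map⁺ _ IH ⟩
    replace i (φ a) i ∷ map (replace i (φ a)) T ≡⟨ cong₂ _∷_ (cong (if_then φ a else i) (≡ᵇ-true {i} refl)) (replace-id T (All-<⇒≢ lt)) ⟩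
    φ a ∷ T                                                              ∎)

-- Enumeration of the suffixes

-- The decomposition carries an equation so that any list can be split; matching it with `refl`
-- gives the form `b ++ a ∷ c` that the constructors of `Suffix` demand.
record Split {A : Set} (xs : List A) : Set where
  constructor split
  field
    before : List A
    mid : A
    after : List A
    eq : before ++ mid ∷ after ≡ xs
open Split

split-∷ : ∀ {A : Set} (x : A) {xs} → Split xs → Split (x ∷ xs)
split-∷ x (split b a c eq) = split (x ∷ b) a c (cong (x ∷_) eq)

splits : ∀ {A : Set} (xs : List A) → List (Split xs)
splits [] = []
splits (x ∷ xs) = split [] x xs refl ∷ map (split-∷ x) (splits xs)

record Item (e : Bool) (r i : ℕ) (T : List ℕ) : Set where
  constructor item
  field
    {missing word} : List ℕ
    derivation : Suffix e r i T missing word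
open Item

module _ {r i : ℕ} {T : List ℕ} where
  fixItem : ∀ {e} → Item (not e) r (suc i) T → Item e (suc r) i T
  fixItem (item d) = item (fixed d)

  driseItem : (x : Item true r (suc i) T) → Split (missing x) → Item false (suc r) i T
  driseItem (item d) (split b a c refl) = item (drise b a c d)

  valleyItem : (x : Item true r (suc i) (i ∷ T)) → Split (missing x) → Item false (suc r) i T
  valleyItem (item d) (split b a c refl) = item (valley b a c d)

  peakItem : (p : Split T) → Item false r (suc i) (before p ++ after p) → Item true (suc r) i T
  peakItem (split b a c refl) (item d) = item (peak b a c d)

  dfallItem : (p : Split T) → Item false r (suc i) (i ∷ before p ++ after p) → Item true (suc r) i T
  dfallItem (split b a c refl) (item d) = item (dfall b a c d)

riseItems : ∀ {r i T T′} → ((x : Item true r (suc i) T′) → Split (missing x) → Item false (suc r) i T) →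
  List (Item true r (suc i) T′) → List (Item false (suc r) i T)
riseItems f = concatMap (λ x → map (f x) (splits (missing x)))

-- The recursion follows `T` from left to right. A fall splits `T` first and then generates the
-- remaining suffixes for each result; a rise has to generate the suffix first, since the list `S`
-- from which σ(i) is taken is part of its output.
items : ∀ e r i T → List (Item e r i T)
fallItemsAt : ∀ r i {T} → Split T → List (Item true (suc r) i T)

items e 0 i [] = item done ∷ []
items e 0 i (_ ∷ _) = []
items false (suc r) i T =
  map fixItem (items true r (suc i) T) ++
  riseItems driseItem (items true r (suc i) T) ++
  riseItems valleyItem (items true r (suc i) (i ∷ T))
items true (suc r) i T = map fixItem (items false r (suc i) T) ++ concatMap (fallItemsAt r i) (splits T)

fallItemsAt r i p =
  map (peakItem p) (items false r (suc i) (before p ++ after p)) ++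
  map (dfallItem p) (items false r (suc i) (i ∷ before p ++ after p))

-- The enumeration is free of repetitions and complete

module _ {A : Set} where
  splits-mid : (xs : List A) → map mid (splits xs) ≡ xs
  splits-mid [] = refl
  splits-mid (x ∷ xs) = cong (x ∷_) (trans (go (splits xs)) (splits-mid xs))
    where
    go : ∀ ps → map mid (map (split-∷ x) ps) ≡ map mid ps
    go [] = refl
    go (p ∷ ps) = cong (mid p ∷_) (go ps)

  ∈-splits : ∀ b (a : A) c → split b a c refl ∈ splits (b ++ a ∷ c)
  ∈-splits [] a c = here refl
  ∈-splits (x ∷ b) a c = there (∈-map⁺ (split-∷ x) (∈-splits b a c))

  ∈-middle : ∀ b {a : A} {c} → a ∈ b ++ a ∷ c
  ∈-middle b = ∈-++⁺ʳ b (here refl)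

  mid∈ : ∀ {xs : List A} (p : Split xs) → mid p ∈ xs
  mid∈ (split b a c refl) = ∈-middle b

iota-≥ : ∀ s r → All (s ≤_) (iota s r)
iota-≥ s zero = []
iota-≥ s (suc r) = ≤-refl ∷ All.map <⇒≤ (iota-≥ (suc s) r)

iota-<-+ : ∀ s r → All (_< s + r) (iota s r)
iota-<-+ s zero = []
iota-<-+ s (suc r) = m<m+n s (s≤s z≤n) ∷ subst (λ t → All (_< t) (iota (suc s) r)) (sym (+-suc s r)) (iota-<-+ (suc s) r)

∈-iota : ∀ {v} s r → s ≤ v → v < s + r → v ∈ iota s r
∈-iota s zero le lt = contradiction (<-≤-trans lt (≤-reflexive (+-identityʳ s))) (≤⇒≯ le)
∈-iota {v} s (suc r) le lt with s ≟ v
... | yes refl = here refl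
... | no s≢v = there (∈-iota (suc s) r (≤∧≢⇒< le s≢v) (subst (v <_) (+-suc s r) lt))

iota-unique : ∀ s r → Unique (iota s r)
iota-unique s zero = []
iota-unique s (suc r) = All.map <⇒≢ (iota-≥ (suc s) r) ∷ iota-unique (suc s) r

low∈word⇒∈T : ∀ {e r i T S u v} → Suffix e r i T S u → v < i → v ∈ u → v ∈ T
low∈word⇒∈T {i = i} {T} d lt v∈u with ∈-++⁻ T (∈-resp-↭ (suffix-↭ d) (∈-++⁺ˡ v∈u))
... | inj₁ v∈T = v∈T
... | inj₂ v∈iota = contradiction lt (≤⇒≯ (All.lookup (iota-≥ i _) v∈iota))

∈T⇒∈word : ∀ {e r i T S u v} → Suffix e r i T S u → v < i → v ∈ T → v ∈ u
∈T⇒∈word {u = u} d lt v∈T with ∈-++⁻ u (∈-resp-↭ (↭-sym (suffix-↭ d)) (∈-++⁺ˡ v∈T))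
... | inj₁ v∈u = v∈u
... | inj₂ v∈S = contradiction lt (≤⇒≯ (All.lookup (proj₁ (suffix-above d)) v∈S))

high∉word⇒∈S : ∀ {e r i T S u v} → Suffix e r i T S u → i ≤ v → v < i + r → v ∉ u → v ∈ S
high∉word⇒∈S {r = r} {i} {T} {u = u} d le lt v∉u
  with ∈-++⁻ u (∈-resp-↭ (↭-sym (suffix-↭ d)) (∈-++⁺ʳ T (∈-iota i r le lt)))
... | inj₁ v∈u = contradiction v∈u v∉u
... | inj₂ v∈S = v∈S

below⇒∉ : ∀ {i T} → All (_< i) T → i ∉ T
below⇒∉ lt i∈T = <-irrefl refl (All.lookup lt i∈T)

_≠ʷ_ : ∀ {e r i T} → Item e r i T → Item e r i T → Set
x ≠ʷ y = word x ≢ word y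

module _ {A B : Set} {R : B → B → Set} where
  AllPairs-concatMap : ∀ {Q : A → A → Set} (f : A → List B) {xs} →
    All (λ x → AllPairs R (f x)) xs →
    (∀ {x y} → Q x y → ∀ {z w} → z ∈ f x → w ∈ f y → R z w) →
    AllPairs Q xs → AllPairs R (concatMap f xs)
  AllPairs-concatMap f {xs} h₁ h₂ ps = APP.concat⁺
    (AllP.map⁺ h₁)
    (APP.map⁺ (AP.map (λ q → All.tabulate λ z∈ → All.tabulate λ w∈ → h₂ q z∈ w∈) ps))

splits-distinct : ∀ {xs : List ℕ} → AllPairs _≢_ xs → AllPairs (_≢_ on mid) (splits xs)
splits-distinct {xs} ps = APP.map⁻ (subst (AllPairs _≢_) (sym (splits-mid xs)) ps)

word-driseItem : ∀ {r i T} (x : Item true r (suc i) T) p → word (driseItem x p) ≡ mid p ∷ word x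
word-driseItem (item d) (split b a c refl) = refl

word-valleyItem : ∀ {r i T} (x : Item true r (suc i) (i ∷ T)) p → word (valleyItem x p) ≡ mid p ∷ word x
word-valleyItem (item d) (split b a c refl) = refl

word-peakItem : ∀ {r i T} (p : Split T) (x : Item false r (suc i) _) → word (peakItem p x) ≡ mid p ∷ word x
word-peakItem (split b a c refl) (item d) = refl

word-dfallItem : ∀ {r i T} (p : Split T) (x : Item false r (suc i) _) → word (dfallItem p x) ≡ mid p ∷ word x
word-dfallItem (split b a c refl) (item d) = refl

∈-fallItemsAt : ∀ {r i T} (p : Split T) {x} → x ∈ fallItemsAt r i p → ∃ λ u → word x ≡ mid p ∷ u
∈-fallItemsAt {r} {i} p x∈ with ∈-++⁻ (map (peakItem p) (items false r (suc i) (before p ++ after p))) x∈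
... | inj₁ x∈₁ with ∈-map⁻ _ x∈₁
... | y , _ , refl = _ , word-peakItem p y
∈-fallItemsAt {r} {i} p x∈ | inj₂ x∈₂ with ∈-map⁻ _ x∈₂
... | y , _ , refl = _ , word-dfallItem p y

module _ {r i T T′} (f : (x : Item true r (suc i) T′) → Split (missing x) → Item false (suc r) i T)
         (word-f : ∀ x p → word (f x p) ≡ mid p ∷ word x) where
  ∈-riseItemsAt : ∀ x {z} → z ∈ map (f x) (splits (missing x)) →
    ∃ λ (p : Split (missing x)) → word z ≡ mid p ∷ word x
  ∈-riseItemsAt x z∈ with ∈-map⁻ (f x) z∈
  ... | p , _ , refl = p , word-f x p

  ∈-riseItems : ∀ xs {z} → z ∈ riseItems f xs →
    ∃ λ x → ∃ λ (p : Split (missing x)) → word z ≡ mid p ∷ word x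
  ∈-riseItems xs z∈ with find (∈-concatMap⁻ (λ x → map (f x) (splits (missing x))) {xs} z∈)
  ... | x , _ , z∈′ = x , ∈-riseItemsAt x z∈′

  riseItems-distinct : ∀ {xs} → AllPairs _≠ʷ_ xs → AllPairs _≠ʷ_ (riseItems f xs)
  riseItems-distinct {xs} = AllPairs-concatMap _
    (All.universal (λ x → APP.map⁺ (AP.map
      (λ {p} {q} ne eq → ne (∷-injectiveˡ (trans (sym (word-f x p)) (trans eq (word-f x q)))))
      (splits-distinct (AP.map <⇒≢ (proj₂ (suffix-above (derivation x))))))) xs)
    (λ {x} {y} ne z∈ w∈ eq → ne (∷-injectiveʳ
      (trans (sym (proj₂ (∈-riseItemsAt x z∈))) (trans eq (proj₂ (∈-riseItemsAt y w∈))))))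

-- The word determines the choices made. Its first letter tells a fixed point from the rest and
-- identifies the split; whether `i` occurs among the later letters tells a peak from a double fall
-- and a double rise from a valley.
items-distinct : ∀ e r i T → Below i T → AllPairs _≠ʷ_ (items e r i T)

fallItemsAt-distinct : ∀ r i {T} (p : Split T) → Below i T → AllPairs _≠ʷ_ (fallItemsAt r i p)
fallItemsAt-distinct r i p@(split b a c refl) below = APP.++⁺
  (APP.map⁺ (AP.map (λ {x} {y} ne eq → ne (∷-injectiveʳ (trans (sym (word-peakItem p x)) (trans eq (word-peakItem p y)))))
    (items-distinct false r (suc i) (b ++ c) (below-suc below′))))
  (APP.map⁺ (AP.map (λ {x} {y} ne eq → ne (∷-injectiveʳ (trans (sym (word-dfallItem p x)) (trans eq (word-dfallItem p y)))))
    (items-distinct false r (suc i) (i ∷ b ++ c) (below-∷ below′))))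
  (AllP.map⁺ (All.universal (λ x → AllP.map⁺ (All.universal (λ y eq →
    below⇒∉ (proj₁ below′) (low∈word⇒∈T (derivation x) (n<1+n i)
      (subst (i ∈_) (∷-injectiveʳ (trans (sym (word-dfallItem p y)) (trans (sym eq) (word-peakItem p x))))
        (∈T⇒∈word (derivation y) (n<1+n i) (here refl))))) _)) _))
  where
  below′ : Below i (b ++ c)
  below′ = below-drop b below

items-distinct e 0 i [] _ = [] ∷ []
items-distinct e 0 i (_ ∷ _) _ = []
items-distinct true (suc r) i T below = APP.++⁺
  (APP.map⁺ (AP.map (λ ne eq → ne (∷-injectiveʳ eq)) (items-distinct false r (suc i) T (below-suc below))))
  (AllPairs-concatMap (fallItemsAt r i) (All.universal (λ p → fallItemsAt-distinct r i p below) _)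
    (λ {p} {q} ne z∈ w∈ eq → ne (∷-injectiveˡ (trans (sym (proj₂ (∈-fallItemsAt p z∈))) (trans eq (proj₂ (∈-fallItemsAt q w∈))))))
    (splits-distinct (AP.map (λ gt eq → <⇒≢ gt (sym eq)) (proj₂ below))))
  (AllP.map⁺ (All.universal (λ x → All.tabulate λ y∈ eq → ne-fall y∈ (sym eq)) _))
  where
  ne-fall : ∀ {y u} → y ∈ concatMap (fallItemsAt r i) (splits T) → word y ≢ i ∷ u
  ne-fall y∈ eq with find (∈-concatMap⁻ (fallItemsAt r i) {splits T} y∈)
  ... | p , _ , y∈′ = below⇒∉ (proj₁ below)
    (subst (_∈ T) (∷-injectiveˡ (trans (sym (proj₂ (∈-fallItemsAt p y∈′))) eq)) (mid∈ p))
items-distinct false (suc r) i T below = APP.++⁺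
  (APP.map⁺ (AP.map (λ ne eq → ne (∷-injectiveʳ eq)) IH))
  (APP.++⁺
    (riseItems-distinct driseItem word-driseItem IH)
    (riseItems-distinct valleyItem word-valleyItem (items-distinct true r (suc i) (i ∷ T) (below-∷ below)))
    (All.tabulate λ x∈ → All.tabulate λ y∈ →
      drise≠valley (∈-riseItems driseItem word-driseItem (items true r (suc i) T) x∈)
        (∈-riseItems valleyItem word-valleyItem (items true r (suc i) (i ∷ T)) y∈)))
  (AllP.map⁺ (All.universal (λ x → All.tabulate (λ y∈ eq → i≢head y∈ (sym eq))) _))
  where
  IH : AllPairs _≠ʷ_ (items true r (suc i) T)
  IH = items-distinct true r (suc i) T (below-suc below)
  drise≠valley : ∀ {v w} →
    (∃ λ (x : Item true r (suc i) T) → ∃ λ (p : Split (missing x)) → v ≡ mid p ∷ word x) →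
    (∃ λ (y : Item true r (suc i) (i ∷ T)) → ∃ λ (p : Split (missing y)) → w ≡ mid p ∷ word y) → v ≢ w
  drise≠valley (x , _ , refl) (y , _ , refl) eq =
    below⇒∉ (proj₁ below) (low∈word⇒∈T (derivation x) (n<1+n i)
      (subst (i ∈_) (sym (∷-injectiveʳ eq)) (∈T⇒∈word (derivation y) (n<1+n i) (here refl))))
  i≢mid : ∀ {T′ v u} → (∃ λ (x : Item true r (suc i) T′) → ∃ λ (p : Split (missing x)) → v ≡ mid p ∷ word x) →
    v ≢ i ∷ u
  i≢mid (x , p , refl) eq =
    <-irrefl (sym (∷-injectiveˡ eq)) (All.lookup (proj₁ (suffix-above (derivation x))) (mid∈ p))
  i≢head : ∀ {y u} → y ∈ riseItems driseItem (items true r (suc i) T) ++ riseItems valleyItem (items true r (suc i) (i ∷ T)) →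
    word y ≢ i ∷ u
  i≢head y∈ with ∈-++⁻ (riseItems driseItem (items true r (suc i) T)) y∈
  ... | inj₁ y∈₁ = i≢mid (∈-riseItems driseItem word-driseItem (items true r (suc i) T) y∈₁)
  ... | inj₂ y∈₂ = i≢mid (∈-riseItems valleyItem word-valleyItem (items true r (suc i) (i ∷ T)) y∈₂)

items-complete : ∀ {e r i T S u} → Suffix e r i T S u →
  ∃ λ x → x ∈ items e r i T × missing x ≡ S × word x ≡ u
items-complete done = item done , here refl , refl , refl
items-complete (fixed {true} d) with items-complete d
... | x , x∈ , refl , refl = fixItem x , ∈-++⁺ˡ (∈-map⁺ fixItem x∈) , refl , refl
items-complete (fixed {false} d) with items-complete d
... | x , x∈ , refl , refl = fixItem x , ∈-++⁺ˡ (∈-map⁺ fixItem x∈) , refl , refl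
items-complete (peak {r} {i} b a c d) with items-complete d
... | x , x∈ , refl , refl = peakItem (split b a c refl) x ,
  ∈-++⁺ʳ (map fixItem (items false r (suc i) (b ++ a ∷ c)))
    (∈-concatMap⁺ (fallItemsAt r i) (lose (∈-splits b a c) (∈-++⁺ˡ (∈-map⁺ _ x∈)))) , refl , refl
items-complete (dfall {r} {i} b a c d) with items-complete d
... | x , x∈ , refl , refl = dfallItem (split b a c refl) x ,
  ∈-++⁺ʳ (map fixItem (items false r (suc i) (b ++ a ∷ c)))
    (∈-concatMap⁺ (fallItemsAt r i) (lose (∈-splits b a c)
      (∈-++⁺ʳ (map (peakItem (split b a c refl)) (items false r (suc i) (b ++ c))) (∈-map⁺ _ x∈)))) , refl , refl
items-complete (drise {r} {i} {T} b a c d) with items-complete d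
... | x , x∈ , refl , refl = driseItem x (split b a c refl) ,
  ∈-++⁺ʳ (map fixItem (items true r (suc i) T))
    (∈-++⁺ˡ (∈-concatMap⁺ _ (lose x∈ (∈-map⁺ (driseItem x) (∈-splits b a c))))) , refl , refl
items-complete (valley {r} {i} {T} b a c d) with items-complete d
... | x , x∈ , refl , refl = valleyItem x (split b a c refl) ,
  ∈-++⁺ʳ (map fixItem (items true r (suc i) T))
    (∈-++⁺ʳ (riseItems driseItem (items true r (suc i) T))
      (∈-concatMap⁺ _ (lose x∈ (∈-map⁺ (valleyItem x) (∈-splits b a c))))) , refl , refl

-- Derivations for the words of D-permutations

isDFrom : ℕ → List ℕ → Bool
isDFrom i [] = true
isDFrom i (a ∷ u) = (if isEven i then a ≤ᵇ i else i ≤ᵇ a) ∧ isDFrom (suc i) u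

≤ᵇ-true : ∀ {m n} → m ≤ n → (m ≤ᵇ n) ≡ true
≤ᵇ-true le = T⇒≡true (≤⇒≤ᵇ le)
  where
  T⇒≡true : ∀ {b} → Data.Bool.T b → b ≡ true
  T⇒≡true {true} _ = refl

≤ᵇ-true⁻ : ∀ {m n} → (m ≤ᵇ n) ≡ true → m ≤ n
≤ᵇ-true⁻ eq = ≤ᵇ⇒≤ _ _ (subst Data.Bool.T (sym eq) _)

∧-true⁻ : ∀ {a b} → a ∧ b ≡ true → a ≡ true × b ≡ true
∧-true⁻ {true} eq = refl , eq

suffix-isD : ∀ {e r i T S u} → Suffix e r i T S u → isEven i ≡ e → All (_< i) T → isDFrom i u ≡ true
suffix-isD done _ _ = refl
suffix-isD (fixed {i = i} d) refl lt with isEven i in eq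
... | true rewrite ≤ᵇ-true (≤-refl {i}) = suffix-isD d (cong not eq) (All.map m<n⇒m<1+n lt)
... | false rewrite ≤ᵇ-true (≤-refl {i}) = suffix-isD d (cong not eq) (All.map m<n⇒m<1+n lt)
suffix-isD (peak b a c d) eq lt with All-mid⁻ b lt
... | a<i , lt′ rewrite eq | ≤ᵇ-true (<⇒≤ a<i) = suffix-isD d (cong not eq) (All.map m<n⇒m<1+n lt′)
suffix-isD (dfall b a c d) eq lt with All-mid⁻ b lt
... | a<i , lt′ rewrite eq | ≤ᵇ-true (<⇒≤ a<i) =
  suffix-isD d (cong not eq) (n<1+n _ ∷ All.map m<n⇒m<1+n lt′)
suffix-isD (drise b a c d) eq lt
  rewrite eq | ≤ᵇ-true (<⇒≤ (proj₁ (All-mid⁻ b (proj₁ (suffix-above d))))) =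
  suffix-isD d (cong not eq) (All.map m<n⇒m<1+n lt)
suffix-isD (valley b a c d) eq lt
  rewrite eq | ≤ᵇ-true (<⇒≤ (proj₁ (All-mid⁻ b (proj₁ (suffix-above d))))) =
  suffix-isD d (cong not eq) (n<1+n _ ∷ All.map m<n⇒m<1+n lt)

-- In a decreasing list of values at most `i`, the value `i` can only be the head. The view thus
-- decides whether σ⁻¹(i) lies to the right of position `i`.
data Top (i : ℕ) : List ℕ → Set where
  absent : ∀ {T} → Below i T → Top i T
  present : ∀ {T} → Below i T → Top i (i ∷ T)

top : ∀ {i} T → Below (suc i) T → Top i T
top [] _ = absent ([] , [])
top {i} (t ∷ T) (s≤s t≤i ∷ _ , gt ∷ desc) with t ≟ i
... | yes refl = present (gt , desc)
... | no t≢i = absent (t<i ∷ All.map (λ x<t → <-trans x<t t<i) gt , gt ∷ desc)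
  where
  t<i : t < i
  t<i = ≤∧≢⇒< t≤i t≢i

insert-below : ∀ {i a} T → Below i T → a < i → a ∉ T →
  ∃ λ b → ∃ λ c → T ≡ b ++ c × Below i (b ++ a ∷ c)
insert-below [] _ a<i _ = [] , [] , refl , a<i ∷ [] , [] ∷ []
insert-below {a = a} (t ∷ T) (t<i ∷ lt , gt ∷ desc) a<i a∉ with <-cmp a t
... | tri≈ _ a≡t _ = contradiction (here a≡t) a∉
... | tri> _ _ t<a = [] , t ∷ T , refl , a<i ∷ t<i ∷ lt , (t<a ∷ All.map (λ x<t → <-trans x<t t<a) gt) ∷ gt ∷ desc
... | tri< a<t _ _ with insert-below T (lt , desc) a<i (λ a∈ → a∉ (there a∈))
... | b , c , refl , lt′ , desc′ =
  t ∷ b , c , refl , t<i ∷ lt′ , AllP.++⁺ (AllP.++⁻ˡ b gt) (a<t ∷ AllP.++⁻ʳ b gt) ∷ desc′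

-- The type of position `i` is forced by two comparisons: `a` with `i`, and, through `Top`, σ⁻¹(i)
-- with `i`. A value `a` below `i` is new to `T` because the letters are distinct, and is inserted
-- at its place in the order; a value above `i` is found in `S` because it does not recur in `u`.
suffix-exists : ∀ {e} i u → isEven i ≡ e → Unique u → All (_< i + length u) u → isDFrom i u ≡ true →
  ∃ λ T → ∃ λ S → Suffix e (length u) i T S u × Below i T
suffix-exists i [] _ _ _ _ = [] , [] , done , [] , []
suffix-exists {e} i (a ∷ u) eq (a∉ ∷ uniq) (a< ∷ u<) isD with ∧-true⁻ {if isEven i then a ≤ᵇ i else i ≤ᵇ a} isD
... | isD-a , isD-u with suffix-exists {not e} (suc i) u (cong not eq) uniq (subst (λ m → All (_< m) u) (+-suc i (length u)) u<) isD-u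
... | T , S , d , below = go (top T below) (<-cmp a i) d eq
  where
  a∉u : a ∉ u
  a∉u a∈ = All.lookup a∉ a∈ refl
  a≤i : isEven i ≡ true → a ≤ i
  a≤i even = ≤ᵇ-true⁻ (trans (sym (cong (if_then a ≤ᵇ i else (i ≤ᵇ a)) even)) isD-a)
  i≤a : isEven i ≡ false → i ≤ a
  i≤a odd = ≤ᵇ-true⁻ (trans (sym (cong (if_then a ≤ᵇ i else (i ≤ᵇ a)) odd)) isD-a)
  go : ∀ {T e} → Top i T → _ → Suffix (not e) (length u) (suc i) T S u → isEven i ≡ e →
    ∃ λ T → ∃ λ S → Suffix e (suc (length u)) i T S (a ∷ u) × Below i T
  -- Here the value `i` would occur both at position `i` and to its right.
  go (present below) (tri≈ _ refl _) d _ = contradiction (∈T⇒∈word d (n<1+n i) (here refl)) a∉u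
  go (absent below) (tri≈ _ refl _) d _ = _ , _ , fixed d , below
  go {e = false} _ (tri< a<i _ _) d odd = contradiction (i≤a odd) (<⇒≱ a<i)
  go {e = true} _ (tri> _ _ i<a) d even = contradiction (a≤i even) (<⇒≱ i<a)
  go {T} {true} (absent below) (tri< a<i _ _) d _
    with insert-below T below a<i (λ a∈T → a∉u (∈T⇒∈word d (m<n⇒m<1+n a<i) a∈T))
  ... | b , c , refl , below′ = _ , _ , peak b a c d , below′
  go {_ ∷ T} {true} (present below) (tri< a<i _ _) d _
    with insert-below T below a<i (λ a∈T → a∉u (∈T⇒∈word d (m<n⇒m<1+n a<i) (there a∈T)))
  ... | b , c , refl , below′ = _ , _ , dfall b a c d , below′
  go {T} {false} tp (tri> _ _ i<a) d _
    with ∈-∃++ (high∉word⇒∈S d i<a (subst (a <_) (+-suc i (length u)) a<) a∉u)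
  go {T} {false} (absent below) (tri> _ _ i<a) d _ | b , c , refl = _ , _ , drise b a c d , below
  go {_} {false} (present below) (tri> _ _ i<a) d _ | b , c , refl = _ , _ , valley b a c d , below

-- Suffixes and D-permutations

rng≡iota : ∀ m → rng m ≡ iota 1 m
rng≡iota m = go 1 (λ k → k) m (λ _ → refl)
  where
  go : ∀ s (f : ℕ → ℕ) r → (∀ k → suc (f k) ≡ s + k) → map suc (applyUpTo f r) ≡ iota s r
  go s f zero h = refl
  go s f (suc r) h = cong₂ _∷_ (trans (h 0) (+-identityʳ s))
    (go (suc s) (λ k → f (suc k)) r (λ k → trans (h (suc k)) (+-suc s k)))

at-middle : ∀ pre {a u} → at (pre ++ a ∷ u) (suc (length pre)) ≡ a
at-middle [] = refl
at-middle (x ∷ pre) = at-middle pre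

snoc : ∀ pre (a : ℕ) u → (pre ++ a ∷ []) ++ u ≡ pre ++ a ∷ u
snoc pre a u = ++-assoc pre (a ∷ []) u

length-snoc : ∀ pre {a : ℕ} → length (pre ++ a ∷ []) ≡ suc (length pre)
length-snoc pre = trans (length-++ pre) (+-comm (length pre) 1)

isD-suffix : ∀ {w} pre u → w ≡ pre ++ u → ∀ {i} → i ≡ suc (length pre) →
  allL (iota i (length u)) (λ j → if isEven j then at w j ≤ᵇ j else j ≤ᵇ at w j) ≡ isDFrom i u
isD-suffix pre [] _ _ = refl
isD-suffix pre (a ∷ u) refl refl rewrite at-middle pre {a} {u} =
  cong (_ ∧_) (isD-suffix (pre ++ a ∷ []) u (sym (snoc pre a u)) (cong suc (sym (length-snoc pre))))

isD≡isDFrom : ∀ w → isD w ≡ isDFrom 1 w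
isD≡isDFrom w rewrite rng≡iota (length w) = isD-suffix [] w refl refl

∈-insertions⁺ : ∀ x b c → b ++ x ∷ c ∈ insertions x (b ++ c)
∈-insertions⁺ x [] [] = here refl
∈-insertions⁺ x [] (_ ∷ _) = here refl
∈-insertions⁺ x (y ∷ b) c = there (∈-map⁺ (y ∷_) (∈-insertions⁺ x b c))

∈-insertions⁻ : ∀ {x z} ys → z ∈ insertions x ys → ∃ λ b → ∃ λ c → z ≡ b ++ x ∷ c × ys ≡ b ++ c
∈-insertions⁻ [] (here refl) = [] , [] , refl , refl
∈-insertions⁻ (y ∷ ys) (here refl) = [] , y ∷ ys , refl , refl
∈-insertions⁻ (y ∷ ys) (there z∈) with ∈-map⁻ (y ∷_) z∈
... | _ , z∈′ , refl with ∈-insertions⁻ ys z∈′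
... | b , c , refl , refl = y ∷ b , c , refl , refl

insertions-unique : ∀ {x} ys → x ∉ ys → Unique (insertions x ys)
insertions-unique [] _ = [] ∷ []
insertions-unique (y ∷ ys) x∉ =
  AllP.map⁺ (All.universal (λ _ eq → x∉ (here (∷-injectiveˡ eq))) _) ∷
  UP.map⁺ ∷-injectiveʳ (insertions-unique ys (λ x∈ → x∉ (there x∈)))

mid-injective : ∀ {x : ℕ} b b′ {c c′} → x ∉ b ++ c → x ∉ b′ ++ c′ → b ++ x ∷ c ≡ b′ ++ x ∷ c′ → b ++ c ≡ b′ ++ c′
mid-injective [] [] _ _ eq = ∷-injectiveʳ eq
mid-injective [] (y ∷ b′) _ x∉ eq = contradiction (here (∷-injectiveˡ eq)) x∉
mid-injective (y ∷ b) [] x∉ _ eq = contradiction (here (sym (∷-injectiveˡ eq))) x∉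
mid-injective (y ∷ b) (y′ ∷ b′) x∉ x∉′ eq = cong₂ _∷_ (∷-injectiveˡ eq)
  (mid-injective b b′ (λ x∈ → x∉ (there x∈)) (λ x∈ → x∉′ (there x∈)) (∷-injectiveʳ eq))

∈-perms⁻ : ∀ {w} xs → w ∈ perms xs → w ↭ xs
∈-perms⁻ [] (here refl) = ↭-refl
∈-perms⁻ (x ∷ xs) w∈ with find (∈-concatMap⁻ (insertions x) {perms xs} w∈)
... | ys , ys∈ , w∈′ with ∈-insertions⁻ ys w∈′
... | b , c , refl , refl = ↭-trans (pull b x c) (prep x (∈-perms⁻ xs ys∈))

∈-perms⁺ : ∀ {w} xs → w ↭ xs → w ∈ perms xs
∈-perms⁺ [] w↭ with ↭-empty-inv w↭
... | refl = here refl
∈-perms⁺ (x ∷ xs) w↭ with ∈-∃++ (∈-resp-↭ (↭-sym w↭) (here refl))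
... | b , c , refl = ∈-concatMap⁺ (insertions x)
  (lose (∈-perms⁺ xs (drop-∷ (↭-trans (↭-sym (pull b x c)) w↭))) (∈-insertions⁺ x b c))

-- Deleting `x` recovers the permutation into which it was inserted, so insertions into different
-- permutations never meet.
perms-unique : ∀ {xs} → Unique xs → Unique (perms xs)
perms-unique {[]} _ = [] ∷ []
perms-unique {x ∷ xs} (x≢ ∷ uniq) = AllPairs-concatMap (insertions x)
  (All.map (insertions-unique _) x∉)
  (λ {ys} {zs} → λ (ne , x∉ys , x∉zs) z∈ w∈ → distinct ne x∉ys x∉zs (∈-insertions⁻ ys z∈) (∈-insertions⁻ zs w∈))
  (strengthen x∉ (perms-unique uniq))
  where
  x∉ : All (x ∉_) (perms xs)
  x∉ = All.tabulate λ w∈ x∈ → All.lookup x≢ (∈-resp-↭ (∈-perms⁻ xs w∈) x∈) refl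
  strengthen : ∀ {yss} → All (x ∉_) yss → Unique yss → AllPairs (λ ys zs → ys ≢ zs × x ∉ ys × x ∉ zs) yss
  strengthen [] [] = []
  strengthen (p ∷ ps) (q ∷ qs) = All.zipWith (λ (x∉zs , ne) → ne , p , x∉zs) (ps , q) ∷ strengthen ps qs
  distinct : ∀ {ys zs z w : List ℕ} → ys ≢ zs → x ∉ ys → x ∉ zs →
    (∃ λ b → ∃ λ c → z ≡ b ++ x ∷ c × ys ≡ b ++ c) → (∃ λ b → ∃ λ c → w ≡ b ++ x ∷ c × zs ≡ b ++ c) → z ≢ w
  distinct ne x∉ys x∉zs (b , c , refl , refl) (b′ , c′ , refl , refl) eq = ne (mid-injective b b′ x∉ys x∉zs eq)

Dperms-unique : ∀ n → Unique (Dperms n)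
Dperms-unique n = UP.filter⁺ _ (perms-unique (subst Unique (sym (rng≡iota (n + n))) (iota-unique 1 (n + n))))

full-missing : ∀ {e r i S u} → Suffix e r i [] S u → S ≡ []
full-missing {S = []} d = refl
full-missing {S = _ ∷ _} d with length-S≡T d
... | ()

word-↭ : ∀ {e r i S u} → Suffix e r i [] S u → u ↭ iota i r
word-↭ {u = u} d with full-missing d
... | refl = subst (_↭ _) (++-identityʳ u) (suffix-↭ d)

suffix⇒∈Dperms : ∀ n {S w} → Suffix false (n + n) 1 [] S w → w ∈ Dperms n
suffix⇒∈Dperms n {w = w} d = ∈-filter⁺ (λ w → isD w Data.Bool.≟ true)
  (∈-perms⁺ _ (subst (w ↭_) (sym (rng≡iota (n + n))) (word-↭ d)))
  (trans (isD≡isDFrom w) (suffix-isD d refl []))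

∈Dperms⇒suffix : ∀ n {w} → w ∈ Dperms n → ∃ λ S → Suffix false (n + n) 1 [] S w
∈Dperms⇒suffix n {w} w∈ with ∈-filter⁻ (λ w → isD w Data.Bool.≟ true) {xs = perms (rng (n + n))} w∈
... | w∈perms , isDw = go (subst (w ↭_) (rng≡iota (n + n)) (∈-perms⁻ _ w∈perms))
  where
  go : w ↭ iota 1 (n + n) → ∃ λ S → Suffix false (n + n) 1 [] S w
  go w↭ = finish (suffix-exists 1 w refl
    (PermSetoid.Unique-resp-↭ (setoid ℕ) (↭⇒↭ₛ (↭-sym w↭)) (iota-unique 1 (n + n)))
    (All-resp-↭ (↭-sym w↭) (subst (λ m → All (_< suc m) (iota 1 (n + n))) (sym length-w) (iota-<-+ 1 (n + n))))
    (trans (sym (isD≡isDFrom w)) isDw))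
    where
    length-w : length w ≡ n + n
    length-w = trans (↭-length w↭) (length-iota 1 (n + n))
    finish : (∃ λ T → ∃ λ S → Suffix false (length w) 1 T S w × Below 1 T) → ∃ λ S → Suffix false (n + n) 1 [] S w
    finish ([] , S , d , _) = S , subst (λ r → Suffix false r 1 [] S w) length-w d
    -- At position 1 an element of `T` would be a value below 1 in a permutation of 1, ..., 2n.
    finish (t ∷ T , S , d , t<1 ∷ _ , _) = contradiction t<1
      (≤⇒≯ (All.lookup (iota-≥ 1 (n + n)) (∈-resp-↭ w↭ (∈T⇒∈word d t<1 (here refl)))))

-- Two lists without repetitions and with the same members differ only in order, which a sum does
-- not see.
words-↭-Dperms : ∀ n → map word (items false (n + n) 1 []) ↭ Dperms n
words-↭-Dperms n = ∼bag⇒↭ (unique∧set⇒bag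
  (APP.map⁺ (items-distinct false (n + n) 1 [] ([] , [])))
  (Dperms-unique n)
  (mk⇔ to from))
  where
  to : ∀ {w} → w ∈ map word (items false (n + n) 1 []) → w ∈ Dperms n
  to w∈ with ∈-map⁻ word w∈
  ... | x , _ , refl = suffix⇒∈Dperms n (derivation x)
  from : ∀ {w} → w ∈ Dperms n → w ∈ map word (items false (n + n) 1 [])
  from w∈ with items-complete (proj₂ (∈Dperms⇒suffix n w∈))
  ... | x , x∈ , _ , refl = ∈-map⁺ word x∈

-- Statistics at one position

<ᵇ-true : ∀ {m n} → m < n → (m <ᵇ n) ≡ true
<ᵇ-true {m} {n} lt with m <ᵇ n | <⇒<ᵇ lt
... | true | _ = refl

<ᵇ-false : ∀ {m n} → n ≤ m → (m <ᵇ n) ≡ false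
<ᵇ-false {m} {n} le with m <ᵇ n in eq
... | false = refl
... | true = contradiction (<ᵇ⇒< m n (subst Data.Bool.T (sym eq) _)) (≤⇒≯ le)

countL-++ : ∀ xs ys P → countL (xs ++ ys) P ≡ countL xs P + countL ys P
countL-++ [] ys P = refl
countL-++ (x ∷ xs) ys P with P x
... | true = cong suc (countL-++ xs ys P)
... | false = countL-++ xs ys P

countL-↭ : ∀ {xs ys} P → xs ↭ ys → countL xs P ≡ countL ys P
countL-↭ P _↭_.refl = refl
countL-↭ P (prep x p) with P x
... | true = cong suc (countL-↭ P p)
... | false = countL-↭ P p
countL-↭ P (swap x y p) with P x | P y
... | true | true = cong (λ n → suc (suc n)) (countL-↭ P p)
... | true | false = cong suc (countL-↭ P p)
... | false | true = cong suc (countL-↭ P p)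
... | false | false = countL-↭ P p
countL-↭ P (_↭_.trans p q) = trans (countL-↭ P p) (countL-↭ P q)

countL-cong : ∀ {P Q} xs → (∀ x → x ∈ xs → P x ≡ Q x) → countL xs P ≡ countL xs Q
countL-cong [] h = refl
countL-cong {P} {Q} (x ∷ xs) h rewrite h x (here refl) =
  cong (λ n → if Q x then suc n else n) (countL-cong xs (λ y y∈ → h y (there y∈)))

countL-map : ∀ (f : ℕ → ℕ) P xs → countL (map f xs) P ≡ countL xs (λ x → P (f x))
countL-map f P [] = refl
countL-map f P (x ∷ xs) = cong (λ n → if P (f x) then suc n else n) (countL-map f P xs)

countL-none : ∀ {P} xs → All (λ x → P x ≡ false) xs → countL xs P ≡ 0
countL-none [] [] = refl
countL-none (x ∷ xs) (p ∷ ps) rewrite p = countL-none xs ps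

countL-all : ∀ {P} xs → All (λ x → P x ≡ true) xs → countL xs P ≡ length xs
countL-all [] [] = refl
countL-all (x ∷ xs) (p ∷ ps) rewrite p = cong suc (countL-all xs ps)

-- Turns being a record or an antirecord into the vanishing of a count, so that these conditions are
-- transferred to `S` and `T` by the same lemmas as crossings and nestings.
allL≡countL : ∀ P xs → allL xs P ≡ (countL xs (λ x → not (P x)) ≡ᵇ 0)
allL≡countL P [] = refl
allL≡countL P (x ∷ xs) with P x
... | true = allL≡countL P xs
... | false = refl

iota-++ : ∀ s r r′ → iota s (r + r′) ≡ iota s r ++ iota (r + s) r′
iota-++ s zero r′ = refl
iota-++ s (suc r) r′ = cong (s ∷_) (trans (iota-++ (suc s) r r′) (cong (λ t → iota (suc s) r ++ iota t r′) (+-suc r s)))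

map-at : ∀ pre xs suf → map (at (pre ++ xs ++ suf)) (iota (suc (length pre)) (length xs)) ≡ xs
map-at pre [] suf = refl
map-at pre (x ∷ xs) suf = cong₂ _∷_ (at-middle pre)
  (trans (cong₂ (λ w s → map (at w) (iota (suc s) (length xs)))
     (sym (snoc pre x (xs ++ suf))) (sym (length-snoc pre)))
    (map-at (pre ++ x ∷ []) xs suf))

-- The values from `i` on that the suffix lacks are precisely those taken before position `i`.
-- Statistics about large values at earlier positions can thus be read off `S`, although the prefix
-- itself is not recorded in a derivation.
count-outside : ∀ {e r i T S u} pre → Suffix e r i T S u → All (_< i) T →
  i ≡ suc (length pre) → pre ++ u ↭ iota 1 (length pre + r) →
  ∀ Q → (∀ v → v < i → Q v ≡ false) → countL pre Q ≡ countL S Q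
count-outside {r = r} {i} {T} {S} {u} pre d lt refl w↭ Q zeros = +-cancelʳ-≡ (countL u Q) _ _ (begin
  countL pre Q + countL u Q                    ≡⟨ countL-++ pre u Q ⟨
  countL (pre ++ u) Q                          ≡⟨ countL-↭ Q w↭ ⟩
  countL (iota 1 (length pre + r)) Q           ≡⟨ cong (λ xs → countL xs Q) (iota-++ 1 (length pre) r) ⟩
  countL (iota 1 (length pre) ++ iota (length pre + 1) r) Q ≡⟨ countL-++ (iota 1 (length pre)) _ Q ⟩
  countL (iota 1 (length pre)) Q + countL (iota (length pre + 1) r) Q
    ≡⟨ cong₂ _+_ (countL-none _ (All.map (zeros _) (iota-<-+ 1 (length pre)))) (cong (λ s → countL (iota s r) Q) (+-comm (length pre) 1)) ⟩
  countL (iota i r) Q                          ≡⟨ cong (_+ countL (iota i r) Q) (countL-none T (All.map (zeros _) lt)) ⟨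
  countL T Q + countL (iota i r) Q             ≡⟨ countL-++ T _ Q ⟨
  countL (T ++ iota i r) Q                     ≡⟨ countL-↭ Q (suffix-↭ d) ⟨
  countL (u ++ S) Q                            ≡⟨ countL-++ u S Q ⟩
  countL u Q + countL S Q                      ≡⟨ +-comm (countL u Q) _ ⟩
  countL S Q + countL u Q                      ∎)
  where open ≡-Reasoning

-- The counterpart for small values at later positions, which make up `T`.
count-inside : ∀ {e r i T S u} → Suffix e r i T S u →
  ∀ Q → (∀ v → i ≤ v → Q v ≡ false) → countL u Q ≡ countL T Q
count-inside {r = r} {i} {T} {S} {u} d Q zeros = begin
  countL u Q                       ≡⟨ +-identityʳ _ ⟨
  countL u Q + 0                   ≡⟨ cong (countL u Q +_) (countL-none S (All.map (zeros _) (proj₁ (suffix-above d)))) ⟨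
  countL u Q + countL S Q          ≡⟨ countL-++ u S Q ⟨
  countL (u ++ S) Q                ≡⟨ countL-↭ Q (suffix-↭ d) ⟩
  countL (T ++ iota i r) Q         ≡⟨ countL-++ T _ Q ⟩
  countL T Q + countL (iota i r) Q ≡⟨ cong (countL T Q +_) (countL-none _ (All.map (zeros _) (iota-≥ i r))) ⟩
  countL T Q + 0                   ≡⟨ +-identityʳ _ ⟩
  countL T Q                       ∎
  where open ≡-Reasoning

Unique-++-disjoint : ∀ {xs ys : List ℕ} {v} → Unique (xs ++ ys) → v ∈ xs → v ∉ ys
Unique-++-disjoint {x ∷ xs} (x≢ ∷ _) (here refl) v∈ys = All.lookup x≢ (∈-++⁺ʳ xs v∈ys) refl
Unique-++-disjoint {x ∷ xs} (_ ∷ uniq) (there v∈xs) v∈ys = Unique-++-disjoint uniq v∈xs v∈ys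

module Position (pre : List ℕ) (a : ℕ) (u : List ℕ) where
  w : List ℕ
  w = pre ++ a ∷ u

  i : ℕ
  i = suc (length pre)

  open Stats w using (σ; σ⁻¹; m; iter; rec; arec; ucross; unest; lcross; lnest; psnest)

  σi≡a : σ i ≡ a
  σi≡a = at-middle pre

  positions : rng m ≡ iota 1 (length pre) ++ i ∷ iota (suc i) (length u)
  positions = trans (rng≡iota m) (trans (cong (iota 1) (length-++ pre))
    (trans (iota-++ 1 (length pre) (suc (length u)))
      (cong (λ s → iota 1 (length pre) ++ iota s (suc (length u))) (+-comm (length pre) 1))))

  map-before : map σ (iota 1 (length pre)) ≡ pre
  map-before = map-at [] pre (a ∷ u)

  map-after : map σ (iota (suc i) (length u)) ≡ u
  map-after = trans
    (cong₂ (λ w s → map (at w) (iota (suc s) (length u)))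
      (trans (sym (snoc pre a u)) (cong ((pre ++ a ∷ []) ++_) (sym (++-identityʳ u)))) (sym (length-snoc pre)))
    (map-at (pre ++ a ∷ []) u [])

  before< : All (_< i) (iota 1 (length pre))
  before< = iota-<-+ 1 (length pre)

  after> : All (i <_) (iota (suc i) (length u))
  after> = iota-≥ (suc i) (length u)

  count-before : ∀ Q → countL (rng m) (λ j → (j <ᵇ i) ∧ Q (σ j)) ≡ countL pre Q
  count-before Q = begin
    countL (rng m) P                                 ≡⟨ cong (λ xs → countL xs P) positions ⟩
    countL (iota 1 (length pre) ++ i ∷ iota (suc i) (length u)) P ≡⟨ countL-++ (iota 1 (length pre)) _ P ⟩
    countL (iota 1 (length pre)) P + countL (i ∷ iota (suc i) (length u)) P
      ≡⟨ cong₂ _+_ (countL-cong (iota 1 (length pre)) (λ j j∈ → cong (_∧ Q (σ j)) (<ᵇ-true (All.lookup before< j∈))))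
                   (countL-none _ (All.map (λ {j} i≤j → cong (_∧ Q (σ j)) (<ᵇ-false i≤j)) (≤-refl ∷ All.map <⇒≤ after>))) ⟩
    countL (iota 1 (length pre)) (λ j → Q (σ j)) + 0 ≡⟨ +-identityʳ _ ⟩
    countL (iota 1 (length pre)) (λ j → Q (σ j))     ≡⟨ countL-map σ Q (iota 1 (length pre)) ⟨
    countL (map σ (iota 1 (length pre))) Q           ≡⟨ cong (λ xs → countL xs Q) map-before ⟩
    countL pre Q                                     ∎
    where
    open ≡-Reasoning
    P : ℕ → Bool
    P j = (j <ᵇ i) ∧ Q (σ j)

  count-after : ∀ Q → countL (rng m) (λ j → (i <ᵇ j) ∧ Q (σ j)) ≡ countL u Q
  count-after Q = begin
    countL (rng m) P                                 ≡⟨ cong (λ xs → countL xs P) positions ⟩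
    countL (iota 1 (length pre) ++ i ∷ iota (suc i) (length u)) P ≡⟨ countL-++ (iota 1 (length pre)) _ P ⟩
    countL (iota 1 (length pre)) P + countL (i ∷ iota (suc i) (length u)) P
      ≡⟨ cong₂ _+_ (countL-none _ (All.map (λ {j} j<i → cong (_∧ Q (σ j)) (<ᵇ-false (<⇒≤ j<i))) before<))
                   (cong (λ b → if b ∧ Q (σ i) then suc n else n) (<ᵇ-false {i} ≤-refl)) ⟩
    n                                                ≡⟨ countL-cong (iota (suc i) (length u)) (λ j j∈ → cong (_∧ Q (σ j)) (<ᵇ-true (All.lookup after> j∈))) ⟩
    countL (iota (suc i) (length u)) (λ j → Q (σ j)) ≡⟨ countL-map σ Q (iota (suc i) (length u)) ⟨
    countL (map σ (iota (suc i) (length u))) Q       ≡⟨ cong (λ xs → countL xs Q) map-after ⟩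
    countL u Q                                       ∎
    where
    open ≡-Reasoning
    P : ℕ → Bool
    P j = (i <ᵇ j) ∧ Q (σ j)
    n : ℕ
    n = countL (iota (suc i) (length u)) P

  private
    not-if : ∀ b c → not (if b then c else true) ≡ b ∧ not c
    not-if true c = refl
    not-if false c = refl

  rec-count : rec i ≡ (countL pre (λ v → not (v <ᵇ a)) ≡ᵇ 0)
  rec-count rewrite allL≡countL (λ j → if j <ᵇ i then σ j <ᵇ σ i else true) (rng m)
    | countL-cong (rng m) (λ j _ → not-if (j <ᵇ i) (σ j <ᵇ σ i))
    | σi≡a = cong (_≡ᵇ 0) (count-before (λ v → not (v <ᵇ a)))

  arec-count : arec i ≡ (countL u (λ v → not (a <ᵇ v)) ≡ᵇ 0)
  arec-count rewrite allL≡countL (λ j → if i <ᵇ j then σ i <ᵇ σ j else true) (rng m)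
    | countL-cong (rng m) (λ j _ → not-if (i <ᵇ j) (σ i <ᵇ σ j))
    | σi≡a = cong (_≡ᵇ 0) (count-after (λ v → not (a <ᵇ v)))

  ucross-count : ucross i ≡ countL pre (λ v → (i <ᵇ v) ∧ (v <ᵇ a))
  ucross-count rewrite σi≡a = count-before (λ v → (i <ᵇ v) ∧ (v <ᵇ a))

  unest-count : unest i ≡ countL pre (λ v → (i <ᵇ a) ∧ (a <ᵇ v))
  unest-count rewrite σi≡a = count-before (λ v → (i <ᵇ a) ∧ (a <ᵇ v))

  lcross-count : lcross i ≡ countL u (λ v → (a <ᵇ v) ∧ (v <ᵇ i))
  lcross-count rewrite σi≡a = count-after (λ v → (a <ᵇ v) ∧ (v <ᵇ i))

  lnest-count : lnest i ≡ countL u (λ v → (v <ᵇ a) ∧ (a <ᵇ i))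
  lnest-count rewrite σi≡a = count-after (λ v → (v <ᵇ a) ∧ (a <ᵇ i))

  psnest-count : psnest i ≡ countL pre (λ v → i <ᵇ v)
  psnest-count = count-before (λ v → i <ᵇ v)

  inv-spec : i ∈ w → σ⁻¹ i ∈ rng m × σ (σ⁻¹ i) ≡ i
  inv-spec i∈w = go (rng m) (subst (i ∈_) (sym map-all) i∈w)
    where
    map-all : map σ (rng m) ≡ w
    map-all rewrite positions | map-++ σ (iota 1 (length pre)) (i ∷ iota (suc i) (length u)) =
      cong₂ _++_ map-before (cong₂ _∷_ σi≡a map-after)
    -- The fold behind `inv` falls back on 0 only when no listed position carries `i`; the
    -- membership hypothesis excludes this at every stage.
    go : ∀ xs → i ∈ map σ xs →
      let j = foldr (λ j r → if σ j ≡ᵇ i then j else r) 0 xs in j ∈ xs × σ j ≡ i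
    go (x ∷ xs) i∈ with σ x ≟ i
    ... | yes eq rewrite ≡ᵇ-true eq = here refl , eq
    go (x ∷ xs) (here eq) | no ne = contradiction (sym eq) ne
    go (x ∷ xs) (there i∈) | no ne rewrite ≡ᵇ-false ne with go xs i∈
    ... | j∈ , eq = there j∈ , eq

  module _ (a≢i : a ≢ i) (i∈w : i ∈ w) where
    inv-cases : (σ⁻¹ i < i × i ∈ pre) ⊎ (i < σ⁻¹ i × i ∈ u)
    inv-cases with inv-spec i∈w
    ... | j∈ , eq with ∈-++⁻ (iota 1 (length pre)) (subst (σ⁻¹ i ∈_) positions j∈)
    ... | inj₁ j∈₁ = inj₁ (All.lookup before< j∈₁ , subst₂ _∈_ eq map-before (∈-map⁺ σ j∈₁))
    ... | inj₂ (here j≡i) = contradiction (trans (sym σi≡a) (trans (cong σ (sym j≡i)) eq)) a≢i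
    ... | inj₂ (there j∈₂) = inj₂ (All.lookup after> j∈₂ , subst₂ _∈_ eq map-after (∈-map⁺ σ j∈₂))

    inv< : i ∉ u → σ⁻¹ i < i
    inv< i∉u with inv-cases
    ... | inj₁ (lt , _) = lt
    ... | inj₂ (_ , i∈u) = contradiction i∈u i∉u

    inv> : Unique w → i ∈ u → i < σ⁻¹ i
    inv> uniq i∈u with inv-cases
    ... | inj₁ (_ , i∈pre) = contradiction (there i∈u) (Unique-++-disjoint uniq i∈pre)
    ... | inj₂ (gt , _) = gt

-- Orbits and minima of cycles

iter-+ : ∀ w j k v → Stats.iter w (j + k) v ≡ Stats.iter w j (Stats.iter w k v)
iter-+ w zero k v = refl
iter-+ w (suc j) k v = cong (at w) (iter-+ w j k v)

-- Relates the recursion of `follow` on the word to iteration of σ. The bound on the earlier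
-- iterates expresses that the path uses only edges leaving the positions of the suffix.
follow-iter : ∀ {w i} pre u v → w ≡ pre ++ u → i ≡ suc (length pre) →
  ∃ λ k → Stats.iter w k v ≡ follow i u v × (∀ j → j < k → i ≤ Stats.iter w j v)
follow-iter pre [] v _ _ = 0 , refl , λ _ ()
follow-iter {w} {i} pre (a ∷ u) v eq i≡
  with follow-iter {i = suc i} (pre ++ a ∷ []) u v (trans eq (sym (snoc pre a u))) (cong suc (trans i≡ (sym (length-snoc pre))))
     | follow-iter {i = suc i} (pre ++ a ∷ []) u a (trans eq (sym (snoc pre a u))) (cong suc (trans i≡ (sym (length-snoc pre))))
... | k₁ , eq₁ , ge₁ | k₂ , eq₂ , ge₂ with follow (suc i) u v ≟ i
... | no ne rewrite ≡ᵇ-false ne = k₁ , eq₁ , λ j lt → <⇒≤ (ge₁ j lt)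
-- `k₁` steps lead from `v` to `i`, one step from `i` to `a`, and `k₂` more from `a` to the end.
... | yes e rewrite ≡ᵇ-true e = k₂ + suc k₁ , trans (iter-+ w k₂ (suc k₁) v) (trans (cong (iter k₂) iter-suc) eq₂) , ge
  where
  open Stats w using (iter)
  iter-suc : iter (suc k₁) v ≡ a
  iter-suc = trans (cong (at w) (trans eq₁ e)) (trans (cong₂ at eq i≡) (at-middle pre))
  ge : ∀ j → j < k₂ + suc k₁ → i ≤ iter j v
  ge j lt with <-cmp j k₁
  ... | tri< j<k₁ _ _ = <⇒≤ (ge₁ j j<k₁)
  ... | tri≈ _ refl _ = ≤-reflexive (sym (trans eq₁ e))
  ... | tri> _ _ k₁<j = subst (i ≤_)
    (trans (cong (iter (j ∸ suc k₁)) (sym iter-suc)) (trans (sym (iter-+ w (j ∸ suc k₁) (suc k₁) v)) (cong (λ t → iter t v) (m∸n+n≡m k₁<j))))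
    (<⇒≤ (ge₂ (j ∸ suc k₁) (+-cancelʳ-< (suc k₁) _ _ (subst (_< k₂ + suc k₁) (sym (m∸n+n≡m k₁<j)) lt))))

at-≤ : ∀ {m} w → All (_≤ m) w → ∀ j → at w j ≤ m
at-≤ [] _ _ = z≤n
at-≤ (x ∷ w) _ zero = z≤n
at-≤ (x ∷ w) (p ∷ _) (suc zero) = p
at-≤ (x ∷ w) (_ ∷ ps) (suc (suc j)) = at-≤ w ps (suc j)

-- Among σ⁰(i), …, σᵐ(i) two entries coincide, and from there on the orbit repeats.
orbit-≥ : ∀ w {m i} → All (_≤ m) w → 1 ≤ i → i ≤ m →
  (∀ k → k ≤ m → i ≤ Stats.iter w k i) → ∀ k → i ≤ Stats.iter w k i
orbit-≥ w {m} {i} w≤ 1≤i i≤m h = <-rec _ step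
  where
  open Stats w using (iter)
  iter≤m : ∀ k → iter k i ≤ m
  iter≤m zero = i≤m
  iter≤m (suc k) = at-≤ w w≤ (iter k i)
  pred< : ∀ {x} → 1 ≤ x → x ≤ m → x ∸ 1 < m
  pred< {suc x} _ le = le
  1≤iter : ∀ (k : Fin (suc m)) → 1 ≤ iter (toℕ k) i
  1≤iter k = ≤-trans 1≤i (h (toℕ k) (≤-pred (toℕ<n k)))
  -- The iterates with index 0, ..., `m` lie between 1 and `m`; lowering them by one puts `m + 1` of
  -- them into `m` holes.
  f : Fin (suc m) → Fin m
  f k = fromℕ< (pred< (1≤iter k) (iter≤m (toℕ k)))
  pred-cancel : ∀ {x y} → 1 ≤ x → 1 ≤ y → x ∸ 1 ≡ y ∸ 1 → x ≡ y
  pred-cancel {suc x} {suc y} _ _ eq = cong suc eq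
  step : ∀ k → (∀ {k′} → k′ < k → i ≤ iter k′ i) → i ≤ iter k i
  step k IH with k ≤? m
  ... | yes le = h k le
  ... | no k≰m with pigeonhole (n<1+n m) f
  ... | p , q , p<q , fp≡fq = subst (i ≤_) same (IH smaller)
    where
    iter≡ : iter (toℕ p) i ≡ iter (toℕ q) i
    iter≡ = pred-cancel (1≤iter p) (1≤iter q) (fromℕ<-injective _ _ _ _ fp≡fq)
    q≤k : toℕ q ≤ k
    q≤k = ≤-trans (≤-pred (toℕ<n q)) (<⇒≤ (≰⇒> k≰m))
    smaller : (k ∸ toℕ q) + toℕ p < k
    smaller = subst ((k ∸ toℕ q) + toℕ p <_) (m∸n+n≡m q≤k) (+-monoʳ-< (k ∸ toℕ q) p<q)
    same : iter ((k ∸ toℕ q) + toℕ p) i ≡ iter k i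
    same = trans (iter-+ w (k ∸ toℕ q) (toℕ p) i) (trans (cong (iter (k ∸ toℕ q)) iter≡)
      (trans (sym (iter-+ w (k ∸ toℕ q) (toℕ q) i)) (cong (λ t → iter t i) (m∸n+n≡m q≤k))))

allL-true : ∀ P xs → (∀ x → x ∈ xs → P x ≡ true) → allL xs P ≡ true
allL-true P [] h = refl
allL-true P (x ∷ xs) h rewrite h x (here refl) = allL-true P xs (λ y y∈ → h y (there y∈))

allL-true⁻ : ∀ P xs → allL xs P ≡ true → ∀ {x} → x ∈ xs → P x ≡ true
allL-true⁻ P (x ∷ xs) eq (here refl) = proj₁ (∧-true⁻ eq)
allL-true⁻ P (x ∷ xs) eq (there x∈) = allL-true⁻ P xs (proj₂ (∧-true⁻ {P x} eq)) x∈

module _ (pre : List ℕ) (a : ℕ) (u : List ℕ) where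
  open Position pre a u
  open Stats w using (iter; m)

  -- The path from σ(i) either returns to `i` before meeting anything smaller, or stops below `i`
  -- and so exhibits a smaller element of the cycle. The test in `cyc` inspects only the first `m`
  -- iterates, while the end of the path comes with no bound on its length; `orbit-≥` bridges this
  -- gap.
  cycle-minimum : All (_≤ m) w → follow (suc i) u a ≤ i →
    allL (rng m) (λ k → i ≤ᵇ iter k i) ≡ (follow (suc i) u a ≡ᵇ i)
  cycle-minimum w≤ end≤i with follow-iter {w} {suc i} (pre ++ a ∷ []) u a (sym (snoc pre a u)) (cong suc (sym (length-snoc pre)))
  ... | k , iter-k , ge = go (follow (suc i) u a ≟ i)
    where
    iter-a : ∀ j → iter (j + 1) i ≡ iter j a
    iter-a j = trans (iter-+ w j 1 i) (cong (iter j) σi≡a)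
    iter-end : iter (k + 1) i ≡ follow (suc i) u a
    iter-end = trans (iter-a k) iter-k
    i≤m : i ≤ m
    i≤m = subst (i ≤_) (sym (length-++ pre)) (subst (i ≤_) (sym (+-suc (length pre) (length u))) (s≤s (m≤m+n (length pre) (length u))))
    go : _ → _
    go (yes closes) = trans (allL-true _ (rng m) (λ j _ → ≤ᵇ-true (<-rec _ step j))) (sym (≡ᵇ-true closes))
      where
      step : ∀ j → (∀ {j′} → j′ < j → i ≤ iter j′ i) → i ≤ iter j i
      step zero IH = ≤-refl
      step (suc j) IH with j <? k
      ... | yes j<k = <⇒≤ (subst (i <_) (trans (sym (iter-a j)) (cong (λ t → iter t i) (+-comm j 1))) (ge j j<k))
      -- The orbit is back at `i` after `k + 1` steps, so the index `suc j` may be lowered by that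
      -- period to `j ∸ k`.
      ... | no j≮k = subst (i ≤_) same (IH (≤-<-trans (m∸n≤m j k) (n<1+n j)))
        where
        k≤j : k ≤ j
        k≤j = ≮⇒≥ j≮k
        same : iter (j ∸ k) i ≡ iter (suc j) i
        same = trans (cong (iter (j ∸ k)) (sym (trans iter-end closes)))
          (trans (sym (iter-+ w (j ∸ k) (k + 1) i))
            (cong (λ t → iter t i) (trans (sym (+-assoc (j ∸ k) k 1)) (trans (cong (_+ 1) (m∸n+n≡m k≤j)) (+-comm j 1)))))
    go (no open′) = trans isFalse (sym (≡ᵇ-false open′))
      where
      isFalse : allL (rng m) (λ k → i ≤ᵇ iter k i) ≡ false
      isFalse with allL (rng m) (λ k → i ≤ᵇ iter k i) in eq
      ... | false = refl
      ... | true = contradiction (subst (i ≤_) iter-end (orbit-≥ w w≤ (s≤s z≤n) i≤m small (k + 1))) (<⇒≱ (≤∧≢⇒< end≤i open′))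
        where
        small : ∀ j → j ≤ m → i ≤ iter j i
        small zero _ = ≤-refl
        small (suc j) le = ≤ᵇ-true⁻ (allL-true⁻ _ (rng m) eq
          (subst (suc j ∈_) (sym (rng≡iota m)) (∈-iota 1 m (s≤s z≤n) (s≤s le))))

-- Statistics of falls, rises and fixed points

∧-falseˡ : ∀ {x y} → x ≡ false → x ∧ y ≡ false
∧-falseˡ refl = refl

∧-falseʳ : ∀ x {y} → y ≡ false → x ∧ y ≡ false
∧-falseʳ x refl = ∧-zeroʳ x

countL-mono : ∀ {P Q} xs → (∀ x → P x ≡ true → Q x ≡ true) → countL xs P ≤ countL xs Q
countL-mono [] h = z≤n
countL-mono {P} {Q} (x ∷ xs) h with P x in eq
... | true rewrite h x eq = s≤s (countL-mono xs h)
... | false with Q x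
... | true = m≤n⇒m≤1+n (countL-mono xs h)
... | false = countL-mono xs h

countL-split : ∀ {Q} b c → All (λ x → Q x ≡ true) b → All (λ x → Q x ≡ false) c → countL (b ++ c) Q ≡ length b
countL-split {Q} b c hb hc = trans (countL-++ b c Q)
  (trans (cong₂ _+_ (countL-all b hb) (countL-none c hc)) (+-identityʳ _))

countL-split′ : ∀ {Q} b c → All (λ x → Q x ≡ false) b → All (λ x → Q x ≡ true) c → countL (b ++ c) Q ≡ length c
countL-split′ {Q} b c hb hc = trans (countL-++ b c Q) (cong₂ _+_ (countL-none b hb) (countL-all c hc))

<ᵇ-true⁻ : ∀ {m n} → (m <ᵇ n) ≡ true → m < n
<ᵇ-true⁻ {m} {n} eq = <ᵇ⇒< m n (subst Data.Bool.T (sym eq) _)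

nonempty : ∀ (b : List ℕ) {a c} → 1 ≤ length (b ++ a ∷ c)
nonempty [] = s≤s z≤n
nonempty (_ ∷ _) = s≤s z≤n

word-≤ : ∀ {w m} → w ↭ iota 1 m → All (_≤ length w) w
word-≤ {w} {m} w↭ = All-resp-↭ (↭-sym w↭)
  (subst (λ l → All (_≤ l) (iota 1 m)) (sym (trans (↭-length w↭) (length-iota 1 m)))
    (All.map ≤-pred (iota-<-+ 1 m)))

minimal : List ℕ → ℕ → Bool
minimal w i = allL (rng (length w)) (λ k → i ≤ᵇ Stats.iter w k i)

record Inverse (w : List ℕ) (i : ℕ) (below : Bool) : Set where
  open Stats w
  field
    inv<ᵇ : (σ⁻¹ i <ᵇ i) ≡ below
    <ᵇinv : (i <ᵇ σ⁻¹ i) ≡ not below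

record Falls (w : List ℕ) (i larger smaller : ℕ) : Set where
  open Stats w
  field
    σ<ᵇ : (σ i <ᵇ i) ≡ true
    <ᵇσ : (i <ᵇ σ i) ≡ false
    fix≡ : fix i ≡ false
    rec≡ : rec i ≡ false
    arec≡ : arec i ≡ (smaller ≡ᵇ 0)
    lcross≡ : lcross i ≡ larger
    lnest≡ : lnest i ≡ smaller
    minimal≡ : minimal w i ≡ false

record Rises (w : List ℕ) (i smaller larger : ℕ) (closes : Bool) : Set where
  open Stats w
  field
    σ<ᵇ : (σ i <ᵇ i) ≡ false
    <ᵇσ : (i <ᵇ σ i) ≡ true
    fix≡ : fix i ≡ false
    rec≡ : rec i ≡ (larger ≡ᵇ 0)
    arec≡ : arec i ≡ false
    ucross≡ : ucross i ≡ smaller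
    unest≡ : unest i ≡ larger
    minimal≡ : minimal w i ≡ closes

record Fixes (w : List ℕ) (i h : ℕ) : Set where
  open Stats w
  field
    σ<ᵇ : (σ i <ᵇ i) ≡ false
    <ᵇσ : (i <ᵇ σ i) ≡ false
    fix≡ : fix i ≡ true
    rec≡ : rec i ≡ (h ≡ᵇ 0)
    arec≡ : arec i ≡ (h ≡ᵇ 0)
    psnest≡ : psnest i ≡ h
    minimal≡ : minimal w i ≡ true

module _ {pre : List ℕ} {a : ℕ} {u : List ℕ} {r : ℕ} where
  open Position pre a u

  private
    last : w ≡ (pre ++ a ∷ []) ++ u
    last = sym (snoc pre a u)

    snoc-↭ : w ↭ iota 1 (length pre + suc r) → (pre ++ a ∷ []) ++ u ↭ iota 1 (length (pre ++ a ∷ []) + r)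
    snoc-↭ w↭ = subst₂ (λ w l → w ↭ iota 1 l) last
      (trans (+-suc (length pre) r) (cong (_+ r) (sym (length-snoc pre)))) w↭

  module _ (w↭ : w ↭ iota 1 (length pre + suc r)) where
    private
      w≤m : All (_≤ length w) w
      w≤m = word-≤ w↭

      w-unique : Unique w
      w-unique = PermSetoid.Unique-resp-↭ (setoid ℕ) (↭⇒↭ₛ (↭-sym w↭)) (iota-unique 1 _)

      i∈w : i ∈ w
      i∈w = ∈-resp-↭ (↭-sym w↭) (∈-iota 1 _ (s≤s z≤n) (s≤s (subst (i ≤_) (sym (+-suc (length pre) r)) (s≤s (m≤m+n (length pre) r)))))

    inverse-below : a ≢ i → i ∉ u → Inverse w i true
    inverse-below a≢i i∉u = record { inv<ᵇ = <ᵇ-true lt ; <ᵇinv = <ᵇ-false (<⇒≤ lt) }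
      where lt = inv< a≢i i∈w i∉u

    inverse-above : a ≢ i → i ∈ u → Inverse w i false
    inverse-above a≢i i∈u = record { inv<ᵇ = <ᵇ-false (<⇒≤ gt) ; <ᵇinv = <ᵇ-true gt }
      where gt = inv> a≢i i∈w w-unique i∈u

    -- Since `T` is decreasing, `b` holds the later values between σ(i) and `i`, which give
    -- crossings, and `c` the later values below σ(i), which give nestings; an antirecord is a fall
    -- without nestings. It is never a record: `S` is as long as the nonempty `T`, so some earlier
    -- value is at least `i`.
    falls : ∀ {e e′ b c T′ S S′} →
      Suffix e (suc r) i (b ++ a ∷ c) S (a ∷ u) → Below i (b ++ a ∷ c) →
      Suffix e′ r (suc i) T′ S′ u → T′ ≡ b ++ c ⊎ T′ ≡ i ∷ b ++ c →
      Falls w i (length b) (length c)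
    falls {b = b} {c} {T′} {S} D (lt , desc) d T′≡ with AllPairs-mid⁻ b desc | All-mid⁻ b lt
    ... | b>a , a>c , _ | a<i , lt′ = record
      { σ<ᵇ = <ᵇ-true (subst (_< i) (sym σi≡a) a<i)
      ; <ᵇσ = <ᵇ-false (<⇒≤ (subst (_< i) (sym σi≡a) a<i))
      ; fix≡ = ≡ᵇ-false (<⇒≢ (subst (_< i) (sym σi≡a) a<i))
      ; rec≡ = trans rec-count (≡ᵇ-false (>⇒≢ nonzero))
      ; arec≡ = trans arec-count (cong (_≡ᵇ 0) (trans
          (inside _ (λ v lt → cong not (<ᵇ-true (<-≤-trans a<i lt))))
          (countL-split′ b c (All.map (λ lt → cong not (<ᵇ-true lt)) b>a) (All.map (λ lt → cong not (<ᵇ-false (<⇒≤ lt))) a>c))))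
      ; lcross≡ = trans lcross-count (trans
          (inside _ (λ v le → ∧-falseʳ (a <ᵇ v) (<ᵇ-false le)))
          (countL-split b c (All.zipWith (λ (gt , lt) → cong₂ _∧_ (<ᵇ-true gt) (<ᵇ-true lt)) (b>a , AllP.++⁻ˡ b lt′))
            (All.map (λ lt → ∧-falseˡ (<ᵇ-false (<⇒≤ lt))) a>c)))
      ; lnest≡ = trans lnest-count (trans
          (inside _ (λ v le → ∧-falseˡ (<ᵇ-false (<⇒≤ (<-≤-trans a<i le)))))
          (countL-split′ b c (All.map (λ lt → ∧-falseˡ (<ᵇ-false (<⇒≤ lt))) b>a)
            (All.map (λ lt → cong₂ _∧_ (<ᵇ-true lt) (<ᵇ-true a<i)) a>c)))
      ; minimal≡ = trans (cycle-minimum pre a u w≤m (subst (_≤ i) (sym end) (<⇒≤ a<i)))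
          (≡ᵇ-false (λ eq → <⇒≢ a<i (trans (sym end) eq)))
      }
      where
      end : follow (suc i) u a ≡ a
      end = follow-low (suc i) u (m<n⇒m<1+n a<i)
      -- At a double fall the value `i` also lies to the right of position `i`; the predicates
      -- counted are false there, so one argument serves peaks as well.
      inside : ∀ Q → (∀ v → i ≤ v → Q v ≡ false) → countL u Q ≡ countL (b ++ c) Q
      inside Q zeros = trans (count-inside d Q (λ v lt → zeros v (<⇒≤ lt))) (go T′≡)
        where
        go : T′ ≡ b ++ c ⊎ T′ ≡ i ∷ b ++ c → countL T′ Q ≡ countL (b ++ c) Q
        go (inj₁ refl) = refl
        go (inj₂ refl) = cong (λ q → if q then suc (countL (b ++ c) Q) else countL (b ++ c) Q) (zeros i ≤-refl)
      nonzero : 1 ≤ countL pre (λ v → not (v <ᵇ a))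
      nonzero = begin
        1                              ≤⟨ nonempty b ⟩
        length (b ++ a ∷ c)            ≡⟨ length-S≡T D ⟨
        length S                       ≡⟨ countL-all S (All.map (λ le → cong not (<ᵇ-false le)) (proj₁ (suffix-above D))) ⟨
        countL S (λ v → not (v <ᵇ i))  ≡⟨ count-outside pre D lt refl w↭ _ (λ v lt → cong not (<ᵇ-true lt)) ⟨
        countL pre (λ v → not (v <ᵇ i)) ≤⟨ countL-mono pre (λ v → weaken v) ⟩
        countL pre (λ v → not (v <ᵇ a)) ∎
        where
        open ≤-Reasoning
        weaken : ∀ v → not (v <ᵇ i) ≡ true → not (v <ᵇ a) ≡ true
        weaken v h with v <ᵇ a in eq
        ... | false = refl
        ... | true with trans (sym h) (cong not (<ᵇ-true (<-trans (<ᵇ-true⁻ eq) a<i)))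
        ... | ()

    rises : ∀ {e b c T′} →
      -- The mirror image of `falls`: as `S` is increasing, `b` again counts crossings and `c`
      -- nestings, and a record is a rise without nestings. It is never an antirecord, because `T′`
      -- is as long as the nonempty list of missing values and supplies a later value at most `i`.
      Suffix e r (suc i) T′ (b ++ a ∷ c) u → All (_< suc i) T′ →
      Rises w i (length b) (length c) (follow (suc i) u a ≡ᵇ i)
    rises {b = b} {c} {T′} d lt with suffix-above d
    ... | ge , asc with AllPairs-mid⁻ b asc | All-mid⁻ b ge
    ... | b<a , a<c , _ | i<a , i<bc = record
      { σ<ᵇ = <ᵇ-false (<⇒≤ (subst (i <_) (sym σi≡a) i<a))
      ; <ᵇσ = <ᵇ-true (subst (i <_) (sym σi≡a) i<a)
      ; fix≡ = ≡ᵇ-false (>⇒≢ (subst (i <_) (sym σi≡a) i<a))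
      ; rec≡ = trans rec-count (cong (_≡ᵇ 0) (trans
          (outside _ (λ v lt → cong not (<ᵇ-true (≤-<-trans (≤-pred lt) i<a))))
          (countL-split′ b c (All.map (λ lt → cong not (<ᵇ-true lt)) b<a) (All.map (λ lt → cong not (<ᵇ-false (<⇒≤ lt))) a<c))))
      ; arec≡ = trans arec-count (≡ᵇ-false (>⇒≢ nonzero))
      ; ucross≡ = trans ucross-count (trans
          (outside _ (λ v lt → ∧-falseˡ (<ᵇ-false (≤-pred lt))))
          (countL-split b c (All.zipWith (λ (lt , gt) → cong₂ _∧_ (<ᵇ-true gt) (<ᵇ-true lt)) (b<a , AllP.++⁻ˡ b i<bc))
            (All.map (λ {v} lt → ∧-falseʳ (i <ᵇ v) (<ᵇ-false (<⇒≤ lt))) a<c)))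
      ; unest≡ = trans unest-count (trans
          (outside _ (λ v lt → ∧-falseʳ (i <ᵇ a) (<ᵇ-false (<⇒≤ (≤-<-trans (≤-pred lt) i<a)))))
          (countL-split′ b c (All.map (λ lt → ∧-falseʳ (i <ᵇ a) (<ᵇ-false (<⇒≤ lt))) b<a)
            (All.map (λ lt → cong₂ _∧_ (<ᵇ-true i<a) (<ᵇ-true lt)) a<c)))
      ; minimal≡ = cycle-minimum pre a u w≤m (≤-pred (All.lookup lt (∈-resp-↭ (follow-↭ d lt) (∈-map⁺ (follow (suc i) u) (∈-middle b)))))
      }
      where
      -- The missing values above `i` are those taken by the positions up to and including `i`; the
      -- contribution of `a` at position `i` itself is cancelled from both sides.
      outside : ∀ Q → (∀ v → v < suc i → Q v ≡ false) → countL pre Q ≡ countL (b ++ c) Q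
      outside Q zeros = +-cancelʳ-≡ (countL (a ∷ []) Q) _ _ (begin
        countL pre Q + countL (a ∷ []) Q     ≡⟨ countL-++ pre (a ∷ []) Q ⟨
        countL (pre ++ a ∷ []) Q             ≡⟨ count-outside (pre ++ a ∷ []) d lt (cong suc (sym (length-snoc pre))) (snoc-↭ w↭) Q zeros ⟩
        countL (b ++ a ∷ c) Q                ≡⟨ countL-↭ Q (pull b a c) ⟩
        countL (a ∷ b ++ c) Q                ≡⟨ countL-++ (a ∷ []) (b ++ c) Q ⟩
        countL (a ∷ []) Q + countL (b ++ c) Q ≡⟨ +-comm (countL (a ∷ []) Q) _ ⟩
        countL (b ++ c) Q + countL (a ∷ []) Q ∎)
        where open ≡-Reasoning
      nonzero : 1 ≤ countL u (λ v → not (a <ᵇ v))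
      nonzero = begin
        1                                   ≤⟨ nonempty b ⟩
        length (b ++ a ∷ c)                 ≡⟨ length-S≡T d ⟩
        length T′                           ≡⟨ countL-all T′ (All.map <ᵇ-true lt) ⟨
        countL T′ (λ v → v <ᵇ suc i)        ≡⟨ count-inside d _ (λ v le → <ᵇ-false le) ⟨
        countL u (λ v → v <ᵇ suc i)         ≤⟨ countL-mono u weaken ⟩
        countL u (λ v → not (a <ᵇ v))       ∎
        where
        open ≤-Reasoning
        weaken : ∀ v → (v <ᵇ suc i) ≡ true → not (a <ᵇ v) ≡ true
        weaken v h = cong not (<ᵇ-false (≤-trans (≤-pred (<ᵇ-true⁻ {v} h)) (<⇒≤ i<a)))

module _ {pre : List ℕ} {u : List ℕ} {r : ℕ} where
  open Position pre (suc (length pre)) u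

  -- Around a fixed point the earlier larger values form `S` and the later smaller ones form `T`,
  -- two lists of the same length `h`. Hence it is a record exactly when it is an antirecord, namely
  -- at height 0, and its `psnest` is `h`.
  fixes : ∀ {e T S} → w ↭ iota 1 (length pre + suc r) → Suffix (not e) r (suc i) T S u → All (_< i) T →
    Fixes w i (length T)
  fixes {e} {T} {S} w↭ d lt = record
    { σ<ᵇ = <ᵇ-false (≤-reflexive (sym σi≡a))
    ; <ᵇσ = <ᵇ-false (≤-reflexive σi≡a)
    ; fix≡ = ≡ᵇ-true σi≡a
    ; rec≡ = trans rec-count (cong (_≡ᵇ 0) (trans
        (outside _ (λ v lt → cong not (<ᵇ-true lt)))
        (trans (countL-all S (All.map (λ lt → cong not (<ᵇ-false (<⇒≤ lt))) above)) (length-S≡T d))))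
    ; arec≡ = trans arec-count (cong (_≡ᵇ 0) (trans
        (count-inside d _ (λ v lt → cong not (<ᵇ-true lt)))
        (countL-all T (All.map (λ lt → cong not (<ᵇ-false (<⇒≤ lt))) lt))))
    ; psnest≡ = trans psnest-count (trans
        (outside _ (λ v lt → <ᵇ-false (<⇒≤ lt)))
        (trans (countL-all S (All.map <ᵇ-true above)) (length-S≡T d)))
    ; minimal≡ = trans (cycle-minimum pre i u (word-≤ w↭) (≤-reflexive end)) (≡ᵇ-true end)
    }
    where
    above : All (i <_) S
    above = proj₁ (suffix-above d)
    end : follow (suc i) u i ≡ i
    end = follow-low (suc i) u (n<1+n i)
    outside : ∀ Q → (∀ v → v < i → Q v ≡ false) → countL pre Q ≡ countL S Q
    outside = count-outside pre (fixed {e} d) lt refl w↭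

-- Weights

module RingLemmas {ℓ₁ ℓ₂ : Level} (R : CommutativeRing ℓ₁ ℓ₂) where
  open CommutativeRing R public
    using (Carrier; _≈_; 0#; 1#; distribˡ; distribʳ; zeroˡ; zeroʳ)
    renaming
      ( refl to ≈-refl; sym to ≈-sym; trans to ≈-trans; reflexive to ≈-reflexive
      ; _+_ to _⊕_; +-assoc to ⊕-assoc; +-comm to ⊕-comm; +-cong to ⊕-cong; +-congˡ to ⊕-congˡ; +-congʳ to ⊕-congʳ
      ; +-identityˡ to ⊕-identityˡ; +-identityʳ to ⊕-identityʳ
      ; _*_ to _⊗_; *-assoc to ⊗-assoc; *-comm to ⊗-comm; *-cong to ⊗-cong; *-congˡ to ⊗-congˡ; *-congʳ to ⊗-congʳ
      ; *-identityˡ to ⊗-identityˡ; *-identityʳ to ⊗-identityʳ )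
  open import Algebra.Properties.CommutativeSemigroup (CommutativeRing.*-commutativeSemigroup R) public
    using () renaming (interchange to ⊗-interchange; x∙yz≈y∙xz to x⊗yz≈y⊗xz; xy∙z≈zy∙x to xyz≈zyx; xy∙z≈xz∙y to xyz≈xzy)
  open import Algebra.Properties.CommutativeSemigroup (CommutativeRing.+-commutativeSemigroup R) public
    using () renaming (interchange to ⊕-interchange)
  open WithRing R public
  module ≈-Reasoning = SetoidReasoning (CommutativeRing.setoid R)

  prodR : List Carrier → Carrier
  prodR = foldr _⊗_ 1#

  factor : Bool → Carrier → Carrier
  factor b x = if b then x else 1#

  prod-⊗ : ∀ (f g : ℕ → Carrier) xs →
    prodR (map f xs) ⊗ prodR (map g xs) ≈ prodR (map (λ i → f i ⊗ g i) xs)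
  prod-⊗ f g [] = ⊗-identityˡ 1#
  prod-⊗ f g (x ∷ xs) = ≈-trans (⊗-interchange _ _ _ _) (⊗-congˡ (prod-⊗ f g xs))

  pow-countL : ∀ x (P : ℕ → Bool) xs → pow x (countL xs P) ≈ prodR (map (λ i → factor (P i) x) xs)
  pow-countL x P [] = ≈-refl
  pow-countL x P (i ∷ xs) with P i
  ... | true = ⊗-congˡ (pow-countL x P xs)
  ... | false = ≈-trans (pow-countL x P xs) (≈-sym (⊗-identityˡ _))

  pow-+ : ∀ x m n → pow x (m + n) ≈ pow x m ⊗ pow x n
  pow-+ x zero n = ≈-sym (⊗-identityˡ _)
  pow-+ x (suc m) n = ≈-trans (⊗-congˡ (pow-+ x m n)) (≈-sym (⊗-assoc x _ _))

  pow-sumOver : ∀ x (P : ℕ → Bool) (f : ℕ → ℕ) xs →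
    pow x (foldr (λ a b → if P a then f a + b else b) 0 xs) ≈ prodR (map (λ i → factor (P i) (pow x (f i))) xs)
  pow-sumOver x P f [] = ≈-refl
  pow-sumOver x P f (i ∷ xs) with P i
  ... | true = ≈-trans (pow-+ x (f i) _) (⊗-congˡ (pow-sumOver x P f xs))
  ... | false = ≈-trans (pow-sumOver x P f xs) (≈-sym (⊗-identityˡ _))

  -- Wrapping the equation in a record keeps `A` and `f` visible as indices, so that `∙` can
  -- assemble the factor of one position from all 23 parameters.
  record Factors (xs : List ℕ) (A : Carrier) (f : ℕ → Carrier) : Set ℓ₂ where
    constructor factors
    field
      ≈prod : A ≈ prodR (map f xs)
  open Factors public

  infixl 7 _∙_
  _∙_ : ∀ {A B xs f g} → Factors xs A f → Factors xs B g → Factors xs (A ⊗ B) (λ i → f i ⊗ g i)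
  _∙_ {xs = xs} {f} {g} (factors p) (factors q) = factors (≈-trans (⊗-cong p q) (prod-⊗ f g xs))

  -- ones, skip, first and next discard runs of trivial factors in a long left-nested product.
  ones : ℕ → Carrier → Carrier
  ones zero x = x
  ones (suc n) x = ones n x ⊗ 1#

  skip : ∀ n {x y} → x ≈ y → ones n x ≈ y
  skip zero p = p
  skip (suc n) p = ≈-trans (⊗-identityʳ _) (skip n p)

  first : ∀ n {x} → ones n 1# ⊗ x ≈ x
  first n = ≈-trans (⊗-congʳ (skip n ≈-refl)) (⊗-identityˡ _)

  next : ∀ n {x y z} → x ≈ y → ones n x ⊗ z ≈ y ⊗ z
  next n p = ⊗-congʳ (skip n p)

module LocalWeights {ℓ₁ ℓ₂ : Level} (R : CommutativeRing ℓ₁ ℓ₂) (P : WithRing.Params R) where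
  open RingLemmas R
  open Params P

  -- The contribution of one position to the weight.  The arguments say whether it is even, a cycle peak,
  -- double fall, valley, double rise, fixed point, record, antirecord, minimum of its cycle; then come
  -- ucross, unest, lcross, lnest, psnest.
  loc : (ev pk df vl dr fx rc ar mn : Bool) (uc un lc ln ps : ℕ) → Carrier
  loc ev pk df vl dr fx rc ar mn uc un lc ln ps =
    factor (pk ∧ (ar ∧ not rc)) x₁ ⊗ factor (df ∧ (ar ∧ not rc)) x₂ ⊗
    factor (vl ∧ (rc ∧ not ar)) y₁ ⊗ factor (dr ∧ (rc ∧ not ar)) y₂ ⊗
    factor (pk ∧ (not rc ∧ not ar)) u₁ ⊗ factor (df ∧ (not rc ∧ not ar)) u₂ ⊗
    factor (vl ∧ (not rc ∧ not ar)) v₁ ⊗ factor (dr ∧ (not rc ∧ not ar)) v₂ ⊗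
    factor (fx ∧ (not rc ∧ not ar) ∧ ev) wₑ ⊗ factor (fx ∧ (not rc ∧ not ar) ∧ not ev) wₒ ⊗
    factor ((rc ∧ ar) ∧ ev) zₑ ⊗ factor ((rc ∧ ar) ∧ not ev) zₒ ⊗
    factor pk (pow p₋₁ lc) ⊗ factor df (pow p₋₂ lc) ⊗ factor vl (pow p₊₁ uc) ⊗ factor dr (pow p₊₂ uc) ⊗
    factor pk (pow q₋₁ ln) ⊗ factor df (pow q₋₂ ln) ⊗ factor vl (pow q₊₁ un) ⊗ factor dr (pow q₊₂ un) ⊗
    factor (fx ∧ ev) (pow sₑ ps) ⊗ factor (fx ∧ not ev) (pow sₒ ps) ⊗ factor mn λ'

  locAt : List ℕ → ℕ → Carrier
  locAt w i = loc (isEven i) (cpeak i) (cdfall i) (cval i) (cdrise i) (fix i) (rec i) (arec i) (minimal w i)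
    (ucross i) (unest i) (lcross i) (lnest i) (psnest i)
    where open Stats w

  weight≈prod : ∀ w → weight P w ≈ prodR (map (locAt w) (rng (length w)))
  weight≈prod w = ≈prod (
    count x₁ (λ i → cpeak i ∧ earec i) ∙ count x₂ (λ i → cdfall i ∧ earec i) ∙
    count y₁ (λ i → cval i ∧ erec i) ∙ count y₂ (λ i → cdrise i ∧ erec i) ∙
    count u₁ (λ i → cpeak i ∧ nr i) ∙ count u₂ (λ i → cdfall i ∧ nr i) ∙
    count v₁ (λ i → cval i ∧ nr i) ∙ count v₂ (λ i → cdrise i ∧ nr i) ∙
    count wₑ (λ i → fix i ∧ nr i ∧ isEven i) ∙ count wₒ (λ i → fix i ∧ nr i ∧ isOdd i) ∙
    count zₑ (λ i → rar i ∧ isEven i) ∙ count zₒ (λ i → rar i ∧ isOdd i) ∙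
    total p₋₁ cpeak lcross ∙ total p₋₂ cdfall lcross ∙ total p₊₁ cval ucross ∙ total p₊₂ cdrise ucross ∙
    total q₋₁ cpeak lnest ∙ total q₋₂ cdfall lnest ∙ total q₊₁ cval unest ∙ total q₊₂ cdrise unest ∙
    total sₑ (λ i → fix i ∧ isEven i) psnest ∙ total sₒ (λ i → fix i ∧ isOdd i) psnest ∙
    count λ' (minimal w))
    where
    open Stats w
    count : ∀ x P → Factors (rng m) (pow x (cnt P)) (λ i → factor (P i) x)
    count x P = factors (pow-countL x P (rng m))
    total : ∀ x P f → Factors (rng m) (pow x (sumOver P f)) (λ i → factor (P i) (pow x (f i)))
    total x P f = factors (pow-sumOver x P f (rng m))

  -- The weight of a fall or rise with `m` crossings and `n` nestings: without nestings it is an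
  -- exclusive antirecord or record and receives `x`, otherwise it is neither and receives `y`.
  cross : Carrier → Carrier → Carrier → Carrier → ℕ → ℕ → Carrier
  cross p q x y m n = (if n ≡ᵇ 0 then x else y) ⊗ pow p m ⊗ pow q n

  fixWeight : Bool → ℕ → Carrier
  fixWeight true zero = λ' ⊗ zₑ
  fixWeight false zero = λ' ⊗ zₒ
  fixWeight true h@(suc _) = λ' ⊗ pow sₑ h ⊗ wₑ
  fixWeight false h@(suc _) = λ' ⊗ pow sₒ h ⊗ wₒ

  suffixWeight : ∀ {e r i T S u} → Suffix e r i T S u → Carrier
  suffixWeight done = 1#
  suffixWeight (fixed {e} {T = T} d) = fixWeight e (length T) ⊗ suffixWeight d
  suffixWeight (peak b a c d) = cross p₋₁ q₋₁ x₁ u₁ (length b) (length c) ⊗ suffixWeight d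
  suffixWeight (dfall b a c d) = cross p₋₂ q₋₂ x₂ u₂ (length b) (length c) ⊗ suffixWeight d
  suffixWeight (drise b a c d) = cross p₊₂ q₊₂ y₂ v₂ (length b) (length c) ⊗ suffixWeight d
  suffixWeight (valley {i = i} {u = u} b a c d) =
    (cross p₊₁ q₊₁ y₁ v₁ (length b) (length c) ⊗ factor (follow (suc i) u a ≡ᵇ i) λ') ⊗ suffixWeight d

  -- The numerals here and below are the lengths of the runs of trivial factors among the 23 factors
  -- of `loc`, read from the right; `first n` removes `n + 1` leading ones.
  loc-peak : ∀ ev n {uc un lc ps} → loc ev true false false false false false (n ≡ᵇ 0) false uc un lc n ps ≈ cross p₋₁ q₋₁ x₁ u₁ lc n
  loc-peak ev zero = skip 6 (next 3 (next 11 ≈-refl))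
  loc-peak ev (suc n) = skip 6 (next 3 (next 7 (first 3)))

  loc-dfall : ∀ ev n {uc un lc ps} → loc ev false true false false false false (n ≡ᵇ 0) false uc un lc n ps ≈ cross p₋₂ q₋₂ x₂ u₂ lc n
  loc-dfall ev zero = skip 5 (next 3 (next 11 (first 0)))
  loc-dfall ev (suc n) = skip 5 (next 3 (next 7 (first 4)))

  loc-drise : ∀ ev n {uc lc ln ps} → loc ev false false false true false (n ≡ᵇ 0) false false uc n lc ln ps ≈ cross p₊₂ q₊₂ y₂ v₂ uc n
  loc-drise ev zero = skip 3 (next 3 (next 11 (first 2)))
  loc-drise ev (suc n) = skip 3 (next 3 (next 7 (first 6)))

  loc-valley : ∀ ev n mn {uc lc ln ps} → loc ev false false true false false (n ≡ᵇ 0) false mn uc n lc ln ps ≈ cross p₊₁ q₊₁ y₁ v₁ uc n ⊗ factor mn λ'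
  loc-valley ev zero mn = next 3 (next 3 (next 11 (first 1)))
  loc-valley ev (suc n) mn = next 3 (next 3 (next 7 (first 5)))

  loc-fixed : ∀ ev h {uc un lc ln} → loc ev false false false false true (h ≡ᵇ 0) (h ≡ᵇ 0) true uc un lc ln h ≈ fixWeight ev h
  loc-fixed true zero = ≈-trans (next 11 (first 9)) (⊗-comm _ _)
  loc-fixed false zero = ≈-trans (next 10 (first 10)) (⊗-comm _ _)
  loc-fixed true (suc h) = ≈-trans (next 1 (next 11 (first 7))) (xyz≈zyx _ _ _)
  loc-fixed false (suc h) = ≈-trans (next 0 (next 11 (first 8))) (xyz≈zyx _ _ _)

  loc-cong : ∀ {ev pk pk′ df df′ vl vl′ dr dr′ fx fx′ rc rc′ ar ar′ mn mn′ uc uc′ un un′ lc lc′ ln ln′ ps ps′} →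
    pk ≡ pk′ → df ≡ df′ → vl ≡ vl′ → dr ≡ dr′ → fx ≡ fx′ → rc ≡ rc′ → ar ≡ ar′ → mn ≡ mn′ →
    uc ≡ uc′ → un ≡ un′ → lc ≡ lc′ → ln ≡ ln′ → ps ≡ ps′ →
    loc ev pk df vl dr fx rc ar mn uc un lc ln ps ≈ loc ev pk′ df′ vl′ dr′ fx′ rc′ ar′ mn′ uc′ un′ lc′ ln′ ps′
  loc-cong refl refl refl refl refl refl refl refl refl refl refl refl refl = ≈-refl

  module _ {w i m n} (F : Falls w i m n) where
    open Stats w using (σ⁻¹; ucross; unest; lcross; lnest; psnest)
    open Falls F

    locAt-peak : Inverse w i true → locAt w i ≈ cross p₋₁ q₋₁ x₁ u₁ m n
    locAt-peak I = ≈-trans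
      (loc-cong (cong₂ _∧_ inv<ᵇ σ<ᵇ) (∧-falseˡ <ᵇinv) (∧-falseˡ <ᵇinv) (∧-falseʳ (σ⁻¹ i <ᵇ i) <ᵇσ) fix≡ rec≡ arec≡ minimal≡ (refl {x = ucross i}) (refl {x = unest i}) lcross≡ lnest≡ (refl {x = psnest i}))
      (loc-peak (isEven i) n {ucross i} {unest i} {m} {psnest i})
      where open Inverse I

    locAt-dfall : Inverse w i false → locAt w i ≈ cross p₋₂ q₋₂ x₂ u₂ m n
    locAt-dfall I = ≈-trans
      (loc-cong (∧-falseˡ inv<ᵇ) (cong₂ _∧_ <ᵇinv σ<ᵇ) (∧-falseʳ (i <ᵇ σ⁻¹ i) <ᵇσ) (∧-falseˡ inv<ᵇ) fix≡ rec≡ arec≡ minimal≡ (refl {x = ucross i}) (refl {x = unest i}) lcross≡ lnest≡ (refl {x = psnest i}))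
      (loc-dfall (isEven i) n {ucross i} {unest i} {m} {psnest i})
      where open Inverse I

  module _ {w i m n closes} (F : Rises w i m n closes) where
    open Stats w using (σ⁻¹; ucross; unest; lcross; lnest; psnest)
    open Rises F

    locAt-drise : Inverse w i true → closes ≡ false → locAt w i ≈ cross p₊₂ q₊₂ y₂ v₂ m n
    locAt-drise I opened = ≈-trans
      (loc-cong (∧-falseʳ (σ⁻¹ i <ᵇ i) σ<ᵇ) (∧-falseˡ <ᵇinv) (∧-falseˡ <ᵇinv) (cong₂ _∧_ inv<ᵇ <ᵇσ) fix≡ rec≡ arec≡ (trans minimal≡ opened) ucross≡ unest≡ (refl {x = lcross i}) (refl {x = lnest i}) (refl {x = psnest i}))
      (loc-drise (isEven i) n {m} {lcross i} {lnest i} {psnest i})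
      where open Inverse I

    locAt-valley : Inverse w i false → locAt w i ≈ cross p₊₁ q₊₁ y₁ v₁ m n ⊗ factor closes λ'
    locAt-valley I = ≈-trans
      (loc-cong (∧-falseˡ inv<ᵇ) (∧-falseʳ (i <ᵇ σ⁻¹ i) σ<ᵇ) (cong₂ _∧_ <ᵇinv <ᵇσ) (∧-falseˡ inv<ᵇ) fix≡ rec≡ arec≡ minimal≡ ucross≡ unest≡ (refl {x = lcross i}) (refl {x = lnest i}) (refl {x = psnest i}))
      (loc-valley (isEven i) n closes {m} {lcross i} {lnest i} {psnest i})
      where open Inverse I

  locAt-fixed : ∀ {w i h} → Fixes w i h → locAt w i ≈ fixWeight (isEven i) h
  locAt-fixed {w} {i} {h} F = ≈-trans
    (loc-cong (∧-falseʳ (σ⁻¹ i <ᵇ i) σ<ᵇ) (∧-falseʳ (i <ᵇ σ⁻¹ i) σ<ᵇ) (∧-falseʳ (i <ᵇ σ⁻¹ i) <ᵇσ) (∧-falseʳ (σ⁻¹ i <ᵇ i) <ᵇσ)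
      fix≡ rec≡ arec≡ minimal≡ (refl {x = ucross i}) (refl {x = unest i}) (refl {x = lcross i}) (refl {x = lnest i}) psnest≡)
    (loc-fixed (isEven i) h {ucross i} {unest i} {lcross i} {lnest i})
    where
    open Stats w using (σ⁻¹; ucross; unest; lcross; lnest; psnest)
    open Fixes F

  -- The statistics at a position involve the whole word, so the induction over the suffix keeps `w`
  -- fixed and moves the letters already read into `pre`.
  prod-locAt : ∀ {e r i T S u} (d : Suffix e r i T S u) pre {w} →
    w ≡ pre ++ u → i ≡ suc (length pre) → isEven i ≡ e → Below i T → w ↭ iota 1 (length pre + r) →
    prodR (map (locAt w) (iota i r)) ≈ suffixWeight d

  prod-locAt-snoc : ∀ {e r i T S a u} (d : Suffix e r (suc i) T S u) pre {w} →
    w ≡ pre ++ a ∷ u → i ≡ suc (length pre) → not (isEven i) ≡ e → Below (suc i) T → w ↭ iota 1 (length pre + suc r) →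
    prodR (map (locAt w) (iota (suc i) r)) ≈ suffixWeight d
  prod-locAt-snoc {r = r} {a = a} {u} d pre refl refl eq below w↭ = prod-locAt d (pre ++ a ∷ [])
    (sym (snoc pre a u)) (cong suc (sym (length-snoc pre))) eq below
    (subst (λ l → pre ++ a ∷ u ↭ iota 1 l) (trans (+-suc (length pre) r) (cong (_+ r) (sym (length-snoc pre)))) w↭)

  prod-locAt done _ _ _ _ _ _ = ≈-refl
  prod-locAt (fixed d) pre refl refl refl below w↭ = ⊗-cong
    (locAt-fixed (fixes w↭ d (proj₁ below)))
    (prod-locAt-snoc d pre refl refl refl (below-suc below) w↭)
  prod-locAt D@(peak {i = i} b a c d) pre refl refl eq below w↭ = ⊗-cong
    (locAt-peak (falls w↭ D below d (inj₁ refl)) (inverse-below w↭ (<⇒≢ (proj₁ (All-mid⁻ b (proj₁ below))))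
      (λ i∈u → below⇒∉ (proj₁ (below-drop b below)) (low∈word⇒∈T d (n<1+n i) i∈u))))
    (prod-locAt-snoc d pre refl refl (cong not eq) (below-suc (below-drop b below)) w↭)
  prod-locAt D@(dfall {i = i} b a c d) pre refl refl eq below w↭ = ⊗-cong
    (locAt-dfall (falls w↭ D below d (inj₂ refl)) (inverse-above w↭ (<⇒≢ (proj₁ (All-mid⁻ b (proj₁ below))))
      (∈T⇒∈word d (n<1+n i) (here refl))))
    (prod-locAt-snoc d pre refl refl (cong not eq) (below-∷ (below-drop b below)) w↭)
  prod-locAt (drise {i = i} {T} {u} b a c d) pre refl refl eq below w↭ = ⊗-cong
    (locAt-drise (rises w↭ d (proj₁ (below-suc below)))
      (inverse-below w↭ (>⇒≢ (proj₁ (All-mid⁻ b (proj₁ (suffix-above d)))))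
        (λ i∈u → below⇒∉ (proj₁ below) (low∈word⇒∈T d (n<1+n i) i∈u)))
      -- The path from `a` ends in `T`, which does not contain `i`; hence a double rise never closes
      -- a cycle.
      (≡ᵇ-false (λ closes → below⇒∉ (proj₁ below) (subst (_∈ T) closes
        (∈-resp-↭ (follow-↭ d (proj₁ (below-suc below))) (∈-map⁺ (follow (suc i) u) (∈-middle b)))))))
    (prod-locAt-snoc d pre refl refl (cong not eq) (below-suc below) w↭)
  prod-locAt (valley {i = i} b a c d) pre refl refl eq below w↭ = ⊗-cong
    (locAt-valley (rises w↭ d (proj₁ (below-∷ below)))
      (inverse-above w↭ (>⇒≢ (proj₁ (All-mid⁻ b (proj₁ (suffix-above d)))))
        (∈T⇒∈word d (n<1+n i) (here refl))))
    (prod-locAt-snoc d pre refl refl (cong not eq) (below-∷ below) w↭)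

  weight≈suffixWeight : ∀ {m S w} (d : Suffix false m 1 [] S w) → weight P w ≈ suffixWeight d
  weight≈suffixWeight {m} {S} {w} d = ≈-trans (weight≈prod w) (≈-trans
    (≈-reflexive (cong (λ xs → prodR (map (locAt w) xs)) (trans (rng≡iota (length w)) (cong (iota 1) (length-word d)))))
    (prod-locAt d [] refl refl refl ([] , []) (word-↭ d)))

-- Sums over suffixes

module Sums {ℓ₁ ℓ₂ : Level} (R : CommutativeRing ℓ₁ ℓ₂) where
  open RingLemmas R

  sumR-++ : ∀ xs ys → sumR (xs ++ ys) ≈ sumR xs ⊕ sumR ys
  sumR-++ [] ys = ≈-sym (⊕-identityˡ _)
  sumR-++ (x ∷ xs) ys = ≈-trans (⊕-congˡ (sumR-++ xs ys)) (≈-sym (⊕-assoc _ _ _))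

  sumR-↭ : ∀ {xs ys} → xs ↭ ys → sumR xs ≈ sumR ys
  sumR-↭ _↭_.refl = ≈-refl
  sumR-↭ (prep x p) = ⊕-congˡ (sumR-↭ p)
  sumR-↭ (swap x y p) = ≈-trans (⊕-congˡ (⊕-congˡ (sumR-↭ p)))
    (≈-trans (≈-sym (⊕-assoc _ _ _)) (≈-trans (⊕-congʳ (⊕-comm _ _)) (⊕-assoc _ _ _)))
  sumR-↭ (_↭_.trans p q) = ≈-trans (sumR-↭ p) (sumR-↭ q)

  module _ {A : Set} where
    sumMap : (A → Carrier) → List A → Carrier
    sumMap f xs = sumR (map f xs)

    sumMap-cong : ∀ {f g : A → Carrier} xs → (∀ x → f x ≈ g x) → sumMap f xs ≈ sumMap g xs
    sumMap-cong [] h = ≈-refl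
    sumMap-cong (x ∷ xs) h = ⊕-cong (h x) (sumMap-cong xs h)

    sumMap-++ : ∀ (f : A → Carrier) xs ys → sumMap f (xs ++ ys) ≈ sumMap f xs ⊕ sumMap f ys
    sumMap-++ f xs ys = ≈-trans (≈-reflexive (cong sumR (map-++ f xs ys))) (sumR-++ (map f xs) (map f ys))

    sumMap-⊗ˡ : ∀ k (f : A → Carrier) xs → sumMap (λ x → k ⊗ f x) xs ≈ k ⊗ sumMap f xs
    sumMap-⊗ˡ k f [] = ≈-sym (zeroʳ k)
    sumMap-⊗ˡ k f (x ∷ xs) = ≈-trans (⊕-congˡ (sumMap-⊗ˡ k f xs)) (≈-sym (distribˡ k _ _))

    sumMap-⊗ʳ : ∀ k (f : A → Carrier) xs → sumMap (λ x → f x ⊗ k) xs ≈ sumMap f xs ⊗ k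
    sumMap-⊗ʳ k f xs = ≈-trans (sumMap-cong xs (λ x → ⊗-comm (f x) k)) (≈-trans (sumMap-⊗ˡ k f xs) (⊗-comm k _))

  sumMap-map : ∀ {A B : Set} (f : B → Carrier) (g : A → B) xs → sumMap f (map g xs) ≈ sumMap (λ x → f (g x)) xs
  sumMap-map f g xs = ≈-reflexive (cong sumR (sym (map-∘ xs)))

  sumMap-concatMap : ∀ {A B : Set} (f : B → Carrier) (g : A → List B) xs →
    sumMap f (concatMap g xs) ≈ sumMap (λ x → sumMap f (g x)) xs
  sumMap-concatMap f g [] = ≈-refl
  sumMap-concatMap f g (x ∷ xs) = ≈-trans (sumMap-++ f (g x) (concatMap g xs)) (⊕-congˡ (sumMap-concatMap f g xs))

  -- Sum of f m n over m + 1 + n = k.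
  splitSum : (ℕ → ℕ → Carrier) → ℕ → Carrier
  splitSum f zero = 0#
  splitSum f (suc k) = f k 0 ⊕ splitSum (λ m n → f m (suc n)) k

  -- `splitSum` starts with the split whose second part is empty, the order of the terms of `qint`,
  -- while `splits` starts with the one whose first part is empty. Peeling from the other end
  -- reconciles the two.
  splitSum-front : ∀ f k → splitSum f (suc k) ≈ f 0 k ⊕ splitSum (λ m n → f (suc m) n) k
  splitSum-front f zero = ≈-refl
  splitSum-front f (suc k) = begin
    f (suc k) 0 ⊕ splitSum (λ m n → f m (suc n)) (suc k)                   ≈⟨ ⊕-congˡ (splitSum-front (λ m n → f m (suc n)) k) ⟩
    f (suc k) 0 ⊕ (f 0 (suc k) ⊕ splitSum (λ m n → f (suc m) (suc n)) k)   ≈⟨ ⊕-assoc _ _ _ ⟨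
    (f (suc k) 0 ⊕ f 0 (suc k)) ⊕ splitSum (λ m n → f (suc m) (suc n)) k   ≈⟨ ⊕-congʳ (⊕-comm _ _) ⟩
    (f 0 (suc k) ⊕ f (suc k) 0) ⊕ splitSum (λ m n → f (suc m) (suc n)) k   ≈⟨ ⊕-assoc _ _ _ ⟩
    f 0 (suc k) ⊕ splitSum (λ m n → f (suc m) n) (suc k)                   ∎
    where open ≈-Reasoning

  splitSum-cong : ∀ {f g} k → (∀ m n → f m n ≈ g m n) → splitSum f k ≈ splitSum g k
  splitSum-cong zero h = ≈-refl
  splitSum-cong (suc k) h = ⊕-cong (h k 0) (splitSum-cong k (λ m n → h m (suc n)))

  splitSum-⊗ˡ : ∀ x f k → splitSum (λ m n → x ⊗ f m n) k ≈ x ⊗ splitSum f k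
  splitSum-⊗ˡ x f zero = ≈-sym (zeroʳ x)
  splitSum-⊗ˡ x f (suc k) = ≈-trans (⊕-congˡ (splitSum-⊗ˡ x _ k)) (≈-sym (distribˡ x _ _))

  sum-splits : ∀ {A : Set} (f : ℕ → ℕ → Carrier) (xs : List A) →
    sumMap (λ (p : Split xs) → f (length (Split.before p)) (length (Split.after p))) (splits xs) ≈ splitSum f (length xs)
  sum-splits f [] = ≈-refl
  sum-splits f (x ∷ xs) = begin
    f 0 (length xs) ⊕ sumMap F (map (split-∷ x) (splits xs))      ≈⟨ ⊕-congˡ (sumMap-map F (split-∷ x) (splits xs)) ⟩
    f 0 (length xs) ⊕ sumMap (λ p → F (split-∷ x p)) (splits xs)  ≈⟨ ⊕-congˡ (sum-splits (λ m n → f (suc m) n) xs) ⟩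
    f 0 (length xs) ⊕ splitSum (λ m n → f (suc m) n) (length xs)  ≈⟨ splitSum-front f (length xs) ⟨
    splitSum f (suc (length xs))                                  ∎
    where
    open ≈-Reasoning
    F : Split (x ∷ xs) → Carrier
    F p = f (length (Split.before p)) (length (Split.after p))

  qint≈splitSum : ∀ k p q → qint k p q ≈ splitSum (λ m n → pow p m ⊗ pow q n) k
  qint≈splitSum k p q = ≈-trans (≈-reflexive (cong sumR (map-upTo (λ j → pow p (k ∸ suc j) ⊗ pow q j) k)))
    (go (λ m n → pow p m ⊗ pow q n) k)
    where
    go : ∀ f k → sumR (applyUpTo (λ j → f (k ∸ suc j) j) k) ≈ splitSum f k
    go f zero = ≈-refl
    go f (suc k) = ⊕-congˡ (go (λ m n → f m (suc n)) k)

-- From suffixes to weighted paths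

module PathSums {ℓ₁ ℓ₂ : Level} (R : CommutativeRing ℓ₁ ℓ₂) (P : WithRing.Params R) where
  open Sums R
  open RingLemmas R
  open LocalWeights R P
  open Params P
  open Item
  open Split

  crossSum : (p q x y : Carrier) → ℕ → Carrier
  crossSum p q x y zero = 0#
  crossSum p q x y (suc k) = pow p k ⊗ x ⊕ q ⊗ qint k p q ⊗ y

  -- The only choice without nestings gives the term with `x`. Every other choice has at least one
  -- nesting; taking one `q` and the `y` out leaves the `q`-integer of the next lower index.
  splitSum-cross : ∀ p q x y k → splitSum (cross p q x y) k ≈ crossSum p q x y k
  splitSum-cross p q x y zero = ≈-refl
  splitSum-cross p q x y (suc k) = ⊕-cong
    (≈-trans (⊗-identityʳ _) (⊗-comm x (pow p k)))
    (begin
      splitSum (λ m n → y ⊗ pow p m ⊗ pow q (suc n)) k        ≈⟨ splitSum-cong k (λ m n → shuffle (pow p m) (pow q n)) ⟩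
      splitSum (λ m n → q ⊗ y ⊗ (pow p m ⊗ pow q n)) k        ≈⟨ splitSum-⊗ˡ (q ⊗ y) _ k ⟩
      q ⊗ y ⊗ splitSum (λ m n → pow p m ⊗ pow q n) k          ≈⟨ ⊗-congˡ (qint≈splitSum k p q) ⟨
      q ⊗ y ⊗ qint k p q                                      ≈⟨ xyz≈xzy q y (qint k p q) ⟩
      q ⊗ qint k p q ⊗ y                                      ∎)
    where
    open ≈-Reasoning
    shuffle : ∀ a b → y ⊗ a ⊗ (q ⊗ b) ≈ q ⊗ y ⊗ (a ⊗ b)
    shuffle a b = ≈-trans (⊗-interchange y a q b) (⊗-congʳ (⊗-comm y q))

  levelOdd levelEven up down : ℕ → Carrier
  levelOdd h = crossSum p₊₂ q₊₂ y₂ v₂ h ⊕ fixWeight false h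
  levelEven h = crossSum p₋₂ q₋₂ x₂ u₂ h ⊕ fixWeight true h
  up h = (λ' ⊕ nat h) ⊗ pow p₊₁ h ⊗ y₁
  down h = crossSum p₋₁ q₋₁ x₁ u₁ h

  pathSum : Bool → ℕ → ℕ → Carrier
  pathSum e zero zero = 1#
  pathSum e zero (suc h) = 0#
  pathSum false (suc r) h = levelOdd h ⊗ pathSum true r h ⊕ up h ⊗ pathSum true r (suc h)
  -- At height 0 the truncation of `h ∸ 1` does no harm, since `down 0` is zero.
  pathSum true (suc r) h = levelEven h ⊗ pathSum false r h ⊕ down h ⊗ pathSum false r (h ∸ 1)

  itemWeight : ∀ {e r i T} → Item e r i T → Carrier
  itemWeight x = suffixWeight (derivation x)

  length-mid : ∀ (b : List ℕ) {a c} → length (b ++ a ∷ c) ≡ suc (length (b ++ c))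
  length-mid [] = refl
  length-mid (_ ∷ b) = cong suc (length-mid b)

  module _ (v₁≈y₁ : v₁ ≈ y₁) (q₊₁≈p₊₁ : q₊₁ ≈ p₊₁) where
    pow-cong : ∀ {x y} n → x ≈ y → pow x n ≈ pow y n
    pow-cong zero eq = ≈-refl
    pow-cong (suc n) eq = ⊗-cong eq (pow-cong n eq)

    -- The specialisation enters here. The rank of the choice that closes a cycle depends on the
    -- whole suffix, so it could not be matched with a weight depending on rank; once only `m + n`
    -- matters, the closing factor can be summed on its own.
    cross-valley : ∀ m n → cross p₊₁ q₊₁ y₁ v₁ m n ≈ pow p₊₁ (m + n) ⊗ y₁
    cross-valley m n = begin
      (if n ≡ᵇ 0 then y₁ else v₁) ⊗ pow p₊₁ m ⊗ pow q₊₁ n ≈⟨ ⊗-assoc _ _ _ ⟩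
      (if n ≡ᵇ 0 then y₁ else v₁) ⊗ (pow p₊₁ m ⊗ pow q₊₁ n) ≈⟨ ⊗-cong (same (n ≡ᵇ 0)) (⊗-congˡ (pow-cong n q₊₁≈p₊₁)) ⟩
      y₁ ⊗ (pow p₊₁ m ⊗ pow p₊₁ n)                        ≈⟨ ⊗-congˡ (pow-+ p₊₁ m n) ⟨
      y₁ ⊗ pow p₊₁ (m + n)                                ≈⟨ ⊗-comm _ _ ⟩
      pow p₊₁ (m + n) ⊗ y₁                                ∎
      where
      open ≈-Reasoning
      same : ∀ b → (if b then y₁ else v₁) ≈ y₁
      same true = ≈-refl
      same false = v₁≈y₁

    -- The endpoints of the paths starting in S exhaust i ∷ T, so exactly one choice closes a cycle.
    sum-closing : ∀ {r i T S u} → Suffix true r (suc i) (i ∷ T) S u → All (_< i) T →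
      sumMap (λ s → factor (follow (suc i) u s ≡ᵇ i) λ') S ≈ λ' ⊕ nat (length T)
    sum-closing {i = i} {T} {S} {u} d lt = begin
      sumMap (λ s → factor (φ s ≡ᵇ i) λ') S        ≈⟨ sumMap-map (λ v → factor (v ≡ᵇ i) λ') φ S ⟨
      sumMap (λ v → factor (v ≡ᵇ i) λ') (map φ S)  ≈⟨ sumR-↭ (map⁺ _ (follow-↭ d (n<1+n i ∷ All.map m<n⇒m<1+n lt))) ⟩
      sumMap (λ v → factor (v ≡ᵇ i) λ') (i ∷ T)    ≈⟨ ⊕-cong (≈-reflexive (cong (λ b → factor b λ') (≡ᵇ-true {i} refl))) (others T lt) ⟩
      λ' ⊕ nat (length T)                          ∎
      where
      open ≈-Reasoning
      φ : ℕ → ℕ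
      φ = follow (suc i) u
      others : ∀ T → All (_< i) T → sumMap (λ v → factor (v ≡ᵇ i) λ') T ≈ nat (length T)
      others [] [] = ≈-refl
      others (t ∷ T) (lt ∷ lts) = ⊕-cong (≈-reflexive (cong (λ b → factor b λ') (≡ᵇ-false (<⇒≢ lt)))) (others T lts)

    sum-valleys : ∀ {r i T} (x : Item true r (suc i) (i ∷ T)) → All (_< i) T →
      sumMap (λ p → itemWeight (valleyItem x p)) (splits (missing x)) ≈ up (length T) ⊗ itemWeight x
    sum-valleys {r} {i} {T} (item {S} {u} d) lt = begin
      sumMap (λ p → itemWeight (valleyItem (item d) p)) (splits S)        ≈⟨ sumMap-cong (splits S) valleyWeight ⟩
      sumMap (λ p → K ⊗ closing (mid p) ⊗ suffixWeight d) (splits S)      ≈⟨ sumMap-⊗ʳ (suffixWeight d) (λ p → K ⊗ closing (mid p)) (splits S) ⟩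
      sumMap (λ p → K ⊗ closing (mid p)) (splits S) ⊗ suffixWeight d      ≈⟨ ⊗-congʳ (sumMap-⊗ˡ K (λ p → closing (mid p)) (splits S)) ⟩
      K ⊗ sumMap (λ p → closing (mid p)) (splits S) ⊗ suffixWeight d      ≈⟨ ⊗-congʳ (⊗-congˡ (sumMap-map closing mid (splits S))) ⟨
      K ⊗ sumMap closing (map mid (splits S)) ⊗ suffixWeight d            ≈⟨ ⊗-congʳ (⊗-congˡ (≈-reflexive (cong (sumMap closing) (splits-mid S)))) ⟩
      K ⊗ sumMap closing S ⊗ suffixWeight d                               ≈⟨ ⊗-congʳ (⊗-congˡ (sum-closing d lt)) ⟩
      K ⊗ (λ' ⊕ nat (length T)) ⊗ suffixWeight d                          ≈⟨ ⊗-congʳ (≈-trans (⊗-comm _ _) (≈-sym (⊗-assoc _ _ _))) ⟩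
      up (length T) ⊗ suffixWeight d                                      ∎
      where
      open ≈-Reasoning
      K : Carrier
      K = pow p₊₁ (length T) ⊗ y₁
      closing : ℕ → Carrier
      closing s = factor (follow (suc i) u s ≡ᵇ i) λ'
      valleyWeight : ∀ p → itemWeight (valleyItem (item d) p) ≈ K ⊗ closing (mid p) ⊗ suffixWeight d
      -- The list `S` has one element more than `T`, and σ(i) uses up one, so the two ranks add up
      -- to `length T` whatever the choice.
      valleyWeight (split b a c refl) = ⊗-congʳ (⊗-congʳ (≈-trans (cross-valley (length b) (length c))
        (≈-reflexive (cong (λ n → pow p₊₁ n ⊗ y₁) (trans (sym (length-++ b))
          (suc-injective (trans (sym (length-mid b)) (length-S≡T d))))))))

    sum-drises : ∀ {r i T} (x : Item true r (suc i) T) →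
      sumMap (λ p → itemWeight (driseItem x p)) (splits (missing x)) ≈ crossSum p₊₂ q₊₂ y₂ v₂ (length T) ⊗ itemWeight x
    sum-drises {r} {i} {T} (item {S} {u} d) = begin
      sumMap (λ p → itemWeight (driseItem (item d) p)) (splits S)        ≈⟨ sumMap-cong (splits S) driseWeight ⟩
      sumMap (λ p → F p ⊗ suffixWeight d) (splits S)                     ≈⟨ sumMap-⊗ʳ (suffixWeight d) F (splits S) ⟩
      sumMap F (splits S) ⊗ suffixWeight d                               ≈⟨ ⊗-congʳ (sum-splits (cross p₊₂ q₊₂ y₂ v₂) S) ⟩
      splitSum (cross p₊₂ q₊₂ y₂ v₂) (length S) ⊗ suffixWeight d         ≈⟨ ⊗-congʳ (splitSum-cross p₊₂ q₊₂ y₂ v₂ (length S)) ⟩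
      crossSum p₊₂ q₊₂ y₂ v₂ (length S) ⊗ suffixWeight d                 ≈⟨ ⊗-congʳ (≈-reflexive (cong (crossSum p₊₂ q₊₂ y₂ v₂) (length-S≡T d))) ⟩
      crossSum p₊₂ q₊₂ y₂ v₂ (length T) ⊗ suffixWeight d                 ∎
      where
      open ≈-Reasoning
      F : Split S → Carrier
      F p = cross p₊₂ q₊₂ y₂ v₂ (length (before p)) (length (after p))
      driseWeight : ∀ p → itemWeight (driseItem (item d) p) ≈ F p ⊗ suffixWeight d
      driseWeight (split b a c refl) = ≈-refl

    -- Each position contributes a total factor that depends on the height alone, so the list `T`
    -- can be forgotten except for its length; what remains is the step recursion of a weighted
    -- path.
    sum-items : ∀ e r i T → All (_< i) T → sumMap itemWeight (items e r i T) ≈ pathSum e r (length T)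

    sum-fixed : ∀ e r i T → All (_< i) T →
      sumMap itemWeight (map (fixItem {e = e}) (items (not e) r (suc i) T)) ≈ fixWeight e (length T) ⊗ pathSum (not e) r (length T)
    sum-fixed e r i T lt = begin
      sumMap itemWeight (map fixItem (items (not e) r (suc i) T))                        ≈⟨ sumMap-map itemWeight fixItem (items (not e) r (suc i) T) ⟩
      sumMap (λ x → fixWeight e (length T) ⊗ itemWeight x) (items (not e) r (suc i) T)   ≈⟨ sumMap-⊗ˡ _ itemWeight (items (not e) r (suc i) T) ⟩
      fixWeight e (length T) ⊗ sumMap itemWeight (items (not e) r (suc i) T)             ≈⟨ ⊗-congˡ (sum-items (not e) r (suc i) T (All.map m<n⇒m<1+n lt)) ⟩
      fixWeight e (length T) ⊗ pathSum (not e) r (length T)                              ∎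
      where open ≈-Reasoning

    sum-rises : ∀ {r i T T′ k} (f : (x : Item true r (suc i) T′) → Split (missing x) → Item false (suc r) i T) →
      (∀ x → sumMap (λ p → itemWeight (f x p)) (splits (missing x)) ≈ k ⊗ itemWeight x) → All (_< suc i) T′ →
      sumMap itemWeight (riseItems f (items true r (suc i) T′)) ≈ k ⊗ pathSum true r (length T′)
    sum-rises {r} {i} {T} {T′} {k} f hf lt = begin
      sumMap itemWeight (riseItems f xs)                                             ≈⟨ sumMap-concatMap itemWeight _ xs ⟩
      sumMap (λ x → sumMap itemWeight (map (f x) (splits (missing x)))) xs           ≈⟨ sumMap-cong xs (λ x → ≈-trans (sumMap-map itemWeight (f x) (splits (missing x))) (hf x)) ⟩
      sumMap (λ x → k ⊗ itemWeight x) xs                                             ≈⟨ sumMap-⊗ˡ k itemWeight xs ⟩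
      k ⊗ sumMap itemWeight xs                                                       ≈⟨ ⊗-congˡ (sum-items true r (suc i) T′ lt) ⟩
      k ⊗ pathSum true r (length T′)                                                 ∎
      where
      open ≈-Reasoning
      xs : List (Item true r (suc i) T′)
      xs = items true r (suc i) T′

    sum-falls : ∀ r i T (p : Split T) → All (_< i) T →
      sumMap itemWeight (fallItemsAt r i p) ≈
      cross p₋₁ q₋₁ x₁ u₁ (length (before p)) (length (after p)) ⊗ pathSum false r (length T ∸ 1) ⊕
      cross p₋₂ q₋₂ x₂ u₂ (length (before p)) (length (after p)) ⊗ pathSum false r (length T)
    sum-falls r i T p@(split b a c refl) lt = begin
      sumMap itemWeight (map (peakItem p) xs ++ map (dfallItem p) ys)
        ≈⟨ sumMap-++ itemWeight (map (peakItem p) xs) (map (dfallItem p) ys) ⟩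
      sumMap itemWeight (map (peakItem p) xs) ⊕ sumMap itemWeight (map (dfallItem p) ys)
        ≈⟨ ⊕-cong (sumMap-map itemWeight (peakItem p) xs) (sumMap-map itemWeight (dfallItem p) ys) ⟩
      sumMap (λ x → _ ⊗ itemWeight x) xs ⊕ sumMap (λ x → _ ⊗ itemWeight x) ys
        ≈⟨ ⊕-cong (sumMap-⊗ˡ _ itemWeight xs) (sumMap-⊗ˡ _ itemWeight ys) ⟩
      _ ⊗ sumMap itemWeight xs ⊕ _ ⊗ sumMap itemWeight ys
        ≈⟨ ⊕-cong (⊗-congˡ (sum-items false r (suc i) (b ++ c) lt′)) (⊗-congˡ (sum-items false r (suc i) (i ∷ b ++ c) (n<1+n i ∷ lt′))) ⟩
      _ ⊗ pathSum false r (length (b ++ c)) ⊕ _ ⊗ pathSum false r (suc (length (b ++ c)))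
        ≈⟨ ≈-reflexive (cong (λ n → cross p₋₁ q₋₁ x₁ u₁ (length b) (length c) ⊗ pathSum false r (n ∸ 1) ⊕
             cross p₋₂ q₋₂ x₂ u₂ (length b) (length c) ⊗ pathSum false r n) (sym (length-mid b))) ⟩
      _ ∎
      where
      open ≈-Reasoning
      xs = items false r (suc i) (b ++ c)
      ys = items false r (suc i) (i ∷ b ++ c)
      lt′ : All (_< suc i) (b ++ c)
      lt′ = All.map m<n⇒m<1+n (proj₂ (All-mid⁻ b lt))

    sum-items e zero i [] lt = ⊕-identityʳ 1#
    sum-items e zero i (_ ∷ _) lt = ≈-refl
    sum-items false (suc r) i T lt = begin
      sumMap itemWeight (fs ++ ds ++ vs)
        ≈⟨ ≈-trans (sumMap-++ itemWeight fs (ds ++ vs)) (⊕-congˡ (sumMap-++ itemWeight ds vs)) ⟩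
      sumMap itemWeight fs ⊕ (sumMap itemWeight ds ⊕ sumMap itemWeight vs)
        ≈⟨ ⊕-cong (sum-fixed false r i T lt) (⊕-cong
             (sum-rises (driseItem {r}) sum-drises (All.map m<n⇒m<1+n lt))
             (sum-rises (valleyItem {r}) (λ x → sum-valleys x lt) (n<1+n i ∷ All.map m<n⇒m<1+n lt))) ⟩
      fixWeight false h ⊗ V ⊕ (crossSum p₊₂ q₊₂ y₂ v₂ h ⊗ V ⊕ up h ⊗ pathSum true r (suc h))
        ≈⟨ ≈-trans (≈-sym (⊕-assoc _ _ _)) (⊕-congʳ (≈-trans (⊕-comm _ _) (≈-sym (distribʳ V _ _)))) ⟩
      levelOdd h ⊗ V ⊕ up h ⊗ pathSum true r (suc h) ∎
      where
      open ≈-Reasoning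
      h = length T
      V = pathSum true r h
      fs = map fixItem (items true r (suc i) T)
      ds = riseItems driseItem (items true r (suc i) T)
      vs = riseItems valleyItem (items true r (suc i) (i ∷ T))
    sum-items true (suc r) i T lt = begin
      sumMap itemWeight (fs ++ concatMap (fallItemsAt r i) (splits T))
        ≈⟨ ≈-trans (sumMap-++ itemWeight fs _) (⊕-cong (sum-fixed true r i T lt) (sumMap-concatMap itemWeight (fallItemsAt r i) (splits T))) ⟩
      fixWeight true h ⊗ V ⊕ sumMap (λ p → sumMap itemWeight (fallItemsAt r i p)) (splits T)
        ≈⟨ ⊕-congˡ (sumMap-cong (splits T) (λ p → sum-falls r i T p lt)) ⟩
      fixWeight true h ⊗ V ⊕ sumMap (λ p → peaks (length (before p)) (length (after p)) ⊗ V₋ ⊕ dfalls (length (before p)) (length (after p)) ⊗ V) (splits T)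
        ≈⟨ ⊕-congˡ (sumMap-⊕ (splits T)) ⟩
      fixWeight true h ⊗ V ⊕ (sumMap (λ p → peaks (length (before p)) (length (after p)) ⊗ V₋) (splits T) ⊕ sumMap (λ p → dfalls (length (before p)) (length (after p)) ⊗ V) (splits T))
        ≈⟨ ⊕-congˡ (⊕-cong (total p₋₁ q₋₁ x₁ u₁ V₋) (total p₋₂ q₋₂ x₂ u₂ V)) ⟩
      fixWeight true h ⊗ V ⊕ (down h ⊗ V₋ ⊕ crossSum p₋₂ q₋₂ x₂ u₂ h ⊗ V)
        ≈⟨ ≈-trans (⊕-congˡ (⊕-comm _ _)) (≈-trans (≈-sym (⊕-assoc _ _ _)) (⊕-congʳ (≈-trans (⊕-comm _ _) (≈-sym (distribʳ V _ _))))) ⟩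
      levelEven h ⊗ V ⊕ down h ⊗ V₋ ∎
      where
      open ≈-Reasoning
      h = length T
      V = pathSum false r h
      V₋ = pathSum false r (h ∸ 1)
      fs = map fixItem (items false r (suc i) T)
      peaks dfalls : ℕ → ℕ → Carrier
      peaks = cross p₋₁ q₋₁ x₁ u₁
      dfalls = cross p₋₂ q₋₂ x₂ u₂
      sumMap-⊕ : ∀ {A : Set} {f g : A → Carrier} xs → sumMap (λ x → f x ⊕ g x) xs ≈ sumMap f xs ⊕ sumMap g xs
      sumMap-⊕ [] = ≈-sym (⊕-identityˡ 0#)
      sumMap-⊕ (x ∷ xs) = ≈-trans (⊕-congˡ (sumMap-⊕ xs)) (⊕-interchange _ _ _ _)
      total : ∀ p q x y k → sumMap (λ s → cross p q x y (length (before s)) (length (after s)) ⊗ k) (splits T) ≈ crossSum p q x y h ⊗ k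
      total p q x y k = ≈-trans
        (sumMap-⊗ʳ k (λ s → cross p q x y (length (before s)) (length (after s))) (splits T))
        (⊗-congʳ (≈-trans (sum-splits (cross p q x y) T) (splitSum-cross p q x y h)))

    Phat≈pathSum : ∀ n → Phat P n ≈ pathSum false (n + n) 0
    Phat≈pathSum n = begin
      sumMap (weight P) (Dperms n)                             ≈⟨ sumR-↭ (map⁺ (weight P) (words-↭-Dperms n)) ⟨
      sumMap (weight P) (map word (items false (n + n) 1 []))  ≈⟨ sumMap-map (weight P) word (items false (n + n) 1 []) ⟩
      sumMap (λ x → weight P (word x)) (items false (n + n) 1 []) ≈⟨ sumMap-cong (items false (n + n) 1 []) (λ x → weight≈suffixWeight (derivation x)) ⟩
      sumMap itemWeight (items false (n + n) 1 [])             ≈⟨ sum-items false (n + n) 1 [] [] ⟩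
      pathSum false (n + n) 0                                  ∎
      where open ≈-Reasoning

-- The continued fraction

module Convolution {ℓ₁ ℓ₂ : Level} (R : CommutativeRing ℓ₁ ℓ₂) where
  open Sums R
  open RingLemmas R

  tail : Series → Series
  tail f n = f (suc n)

  conv : Series → Series → Series
  conv f g zero = f 0 ⊗ g 0
  conv f g (suc n) = f 0 ⊗ g (suc n) ⊕ conv (tail f) g n

  *S≈conv : ∀ f g n → (f *S g) n ≈ conv f g n
  *S≈conv f g n = ≈-trans (≈-reflexive (cong sumR (map-upTo (λ i → f i ⊗ g (n ∸ i)) (suc n)))) (go f n)
    where
    go : ∀ f n → sumR (applyUpTo (λ i → f i ⊗ g (n ∸ i)) (suc n)) ≈ conv f g n
    go f zero = ⊕-identityʳ _
    go f (suc n) = ⊕-congˡ (go (tail f) n)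

  -- Agreement is required only up to order `n`, as truncated series and fractions need not agree
  -- further.
  conv-cong : ∀ {f f′ g g′} n → (∀ k → k ≤ n → f k ≈ f′ k) → (∀ k → k ≤ n → g k ≈ g′ k) → conv f g n ≈ conv f′ g′ n
  conv-cong zero hf hg = ⊗-cong (hf 0 z≤n) (hg 0 z≤n)
  conv-cong (suc n) hf hg = ⊕-cong (⊗-cong (hf 0 z≤n) (hg (suc n) ≤-refl))
    (conv-cong n (λ k le → hf (suc k) (s≤s le)) (λ k le → hg k (m≤n⇒m≤1+n le)))

  conv-congˡ : ∀ {f f′ g} n → (∀ k → f k ≈ f′ k) → conv f g n ≈ conv f′ g n
  conv-congˡ n h = conv-cong n (λ k _ → h k) (λ _ _ → ≈-refl)

  conv-⊕ˡ : ∀ f f′ g n → conv (f +S f′) g n ≈ conv f g n ⊕ conv f′ g n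
  conv-⊕ˡ f f′ g zero = distribʳ _ _ _
  conv-⊕ˡ f f′ g (suc n) = ≈-trans (⊕-cong (distribʳ _ _ _) (conv-⊕ˡ (tail f) (tail f′) g n)) (⊕-interchange _ _ _ _)

  conv-⊕ʳ : ∀ f g g′ n → conv f (g +S g′) n ≈ conv f g n ⊕ conv f g′ n
  conv-⊕ʳ f g g′ zero = distribˡ _ _ _
  conv-⊕ʳ f g g′ (suc n) = ≈-trans (⊕-cong (distribˡ _ _ _) (conv-⊕ʳ (tail f) g g′ n)) (⊕-interchange _ _ _ _)

  conv-scaleˡ : ∀ k f g n → conv (scale k f) g n ≈ k ⊗ conv f g n
  conv-scaleˡ k f g zero = ⊗-assoc _ _ _
  conv-scaleˡ k f g (suc n) = ≈-trans (⊕-cong (⊗-assoc _ _ _) (conv-scaleˡ k (tail f) g n)) (≈-sym (distribˡ _ _ _))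

  conv-scaleʳ : ∀ k f g n → conv f (scale k g) n ≈ k ⊗ conv f g n
  conv-scaleʳ k f g zero = x⊗yz≈y⊗xz _ _ _
  conv-scaleʳ k f g (suc n) = ≈-trans (⊕-cong (x⊗yz≈y⊗xz _ _ _) (conv-scaleʳ k (tail f) g n)) (≈-sym (distribˡ _ _ _))

  conv-0ˡ : ∀ g n → conv (λ _ → 0#) g n ≈ 0#
  conv-0ˡ g zero = zeroˡ _
  conv-0ˡ g (suc n) = ≈-trans (⊕-cong (zeroˡ _) (conv-0ˡ g n)) (⊕-identityˡ 0#)

  conv-0ʳ : ∀ f n → conv f (λ _ → 0#) n ≈ 0#
  conv-0ʳ f zero = zeroʳ _
  conv-0ʳ f (suc n) = ≈-trans (⊕-cong (zeroʳ _) (conv-0ʳ (tail f) n)) (⊕-identityˡ 0#)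

  conv-oneˡ : ∀ g n → conv oneS g n ≈ g n
  conv-oneˡ g zero = ⊗-identityˡ _
  conv-oneˡ g (suc n) = ≈-trans (⊕-cong (⊗-identityˡ _) (conv-0ˡ g n)) (⊕-identityʳ _)

  conv-assoc : ∀ f g h n → conv (conv f g) h n ≈ conv f (conv g h) n
  conv-assoc f g h zero = ⊗-assoc _ _ _
  conv-assoc f g h (suc n) = begin
    f 0 ⊗ g 0 ⊗ h (suc n) ⊕ conv (scale (f 0) (tail g) +S conv (tail f) g) h n
      ≈⟨ ⊕-cong (⊗-assoc _ _ _) (≈-trans (conv-⊕ˡ (scale (f 0) (tail g)) (conv (tail f) g) h n) (⊕-cong (conv-scaleˡ (f 0) (tail g) h n) (conv-assoc (tail f) g h n))) ⟩
    f 0 ⊗ (g 0 ⊗ h (suc n)) ⊕ (f 0 ⊗ conv (tail g) h n ⊕ conv (tail f) (conv g h) n)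
      ≈⟨ ⊕-assoc _ _ _ ⟨
    f 0 ⊗ (g 0 ⊗ h (suc n)) ⊕ f 0 ⊗ conv (tail g) h n ⊕ conv (tail f) (conv g h) n
      ≈⟨ ⊕-congʳ (distribˡ _ _ _) ⟨
    f 0 ⊗ conv g h (suc n) ⊕ conv (tail f) (conv g h) n ∎
    where open ≈-Reasoning

  conv-tailʳ : ∀ f g n → g 0 ≈ 0# → conv f g (suc n) ≈ conv f (tail g) n
  conv-tailʳ f g zero g0≈0 = ≈-trans (⊕-congˡ (≈-trans (⊗-congˡ g0≈0) (zeroʳ _))) (⊕-identityʳ _)
  conv-tailʳ f g (suc n) g0≈0 = ⊕-congˡ (conv-tailʳ (tail f) g n g0≈0)

  conv-sum : ∀ f (g : ℕ → Series) N n →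
    conv f (λ j → sumR (applyUpTo (λ k → g k j) N)) n ≈ sumR (applyUpTo (λ k → conv f (g k) n) N)
  conv-sum f g zero n = conv-0ʳ f n
  conv-sum f g (suc N) n = ≈-trans (conv-⊕ʳ f (g 0) (λ j → sumR (applyUpTo (λ k → g (suc k) j) N)) n) (⊕-congˡ (conv-sum f (λ k → g (suc k)) N n))

  sum-truncate : ∀ (f : ℕ → Carrier) {m N} → m ≤ N → (∀ k → m ≤ k → f k ≈ 0#) →
    sumR (applyUpTo f N) ≈ sumR (applyUpTo f m)
  sum-truncate f {zero} {zero} _ _ = ≈-refl
  sum-truncate f {zero} {suc N} _ zeros =
    ≈-trans (⊕-cong (zeros 0 z≤n) (sum-truncate (λ k → f (suc k)) {0} {N} z≤n (λ k _ → zeros (suc k) z≤n))) (⊕-identityˡ 0#)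
  sum-truncate f {suc m} {suc N} (s≤s le) zeros = ⊕-congˡ (sum-truncate (λ k → f (suc k)) le (λ k le′ → zeros (suc k) (s≤s le′)))

  sum-cong : ∀ {f g : ℕ → Carrier} N → (∀ k → f k ≈ g k) → sumR (applyUpTo f N) ≈ sumR (applyUpTo g N)
  sum-cong zero h = ≈-refl
  sum-cong (suc N) h = ⊕-cong (h 0) (sum-cong N (λ k → h (suc k)))

  module _ (a : Series) where
    private
      power : ℕ → Series
      power = powS (shiftT a)

    power-zero : ∀ k → power (suc k) 0 ≈ 0#
    power-zero k = ≈-trans (*S≈conv (shiftT a) (power k) 0) (zeroˡ _)

    power-suc : ∀ k n → power (suc k) (suc n) ≈ conv a (power k) n
    power-suc k n = ≈-trans (*S≈conv (shiftT a) (power k) (suc n)) (≈-trans (⊕-congʳ (zeroˡ _)) (⊕-identityˡ _))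

    power-vanish : ∀ k n → n < k → power k n ≈ 0#
    power-vanish (suc k) zero _ = power-zero k
    power-vanish (suc k) (suc n) (s≤s lt) = ≈-trans (power-suc k n)
      (≈-trans (conv-cong n (λ _ _ → ≈-refl) (λ j le → power-vanish k j (≤-<-trans le lt))) (conv-0ʳ a n))

    inv-upTo : ∀ n → invOneMinusT a n ≈ sumR (applyUpTo (λ k → power k n) (suc n))
    inv-upTo n = ≈-reflexive (cong sumR (map-upTo (λ k → power k n) (suc n)))

    inv-zero : invOneMinusT a 0 ≈ 1#
    inv-zero = ⊕-identityʳ 1#

    -- The coefficients of G = 1 + t a G. The geometric sums defining different coefficients have
    -- different lengths; since the k-th power of a series without constant term begins at order k,
    -- they can all be extended to a common length.
    inv-suc : ∀ n → invOneMinusT a (suc n) ≈ conv a (invOneMinusT a) n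
    inv-suc n = begin
      invOneMinusT a (suc n)                                             ≈⟨ inv-upTo (suc n) ⟩
      0# ⊕ sumR (applyUpTo (λ k → power (suc k) (suc n)) (suc n))        ≈⟨ ⊕-identityˡ _ ⟩
      sumR (applyUpTo (λ k → power (suc k) (suc n)) (suc n))             ≈⟨ sum-cong (suc n) (λ k → power-suc k n) ⟩
      sumR (applyUpTo (λ k → conv a (power k) n) (suc n))                ≈⟨ conv-sum a power (suc n) n ⟨
      conv a (λ j → sumR (applyUpTo (λ k → power k j) (suc n))) n        ≈⟨ conv-cong n (λ _ _ → ≈-refl) (λ j le → ≈-trans
                                                                              (sum-truncate (λ k → power k j) (s≤s le) (λ k lt → power-vanish k j lt))
                                                                              (≈-sym (inv-upTo j))) ⟩
      conv a (invOneMinusT a) n                                          ∎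
      where open ≈-Reasoning

-- Unlike `n + n`, this exposes two successors at once, so that `pathSum` unfolds over an odd and an
-- even step together.
double : ℕ → ℕ
double zero = zero
double (suc n) = suc (suc (double n))

double≡+ : ∀ n → double n ≡ n + n
double≡+ zero = refl
double≡+ (suc n) = cong suc (trans (cong suc (double≡+ n)) (sym (+-suc n n)))

isEven-double : ∀ h → isEven (double h) ≡ true
isEven-double zero = refl
isEven-double (suc h) rewrite isEven-double h = refl

half-double : ∀ h → ⌊ double h /2⌋ ≡ h
half-double zero = refl
half-double (suc h) = cong suc (half-double h)

half-suc-double : ∀ h → ⌊ suc (double h) /2⌋ ≡ h
half-suc-double zero = refl
half-suc-double (suc h) = cong suc (half-suc-double h)

-- Limits of the truncated fractions and first descents of paths

module ContinuedFraction {ℓ₁ ℓ₂ : Level} (R : CommutativeRing ℓ₁ ℓ₂) (P : WithRing.Params R) where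
  open Convolution R
  open RingLemmas R
  open PathSums R P
  open LocalWeights R P using (fixWeight)
  open Params P

  coeff : (ℕ → Series) → ℕ → Series
  coeff F lv = scale (δ P (suc lv)) oneS +S scale (α P (suc lv)) (F (suc lv))

  frac-zero : ∀ d lv → frac P d lv 0 ≈ 1#
  frac-zero zero lv = ≈-refl
  frac-zero (suc d) lv = inv-zero (coeff (frac P d) lv)

  -- Every level is entered with a factor t, and the constant coefficient is 1 at any depth, so a
  -- coefficient of order `n` cannot see below depth `n`.
  frac-stable : ∀ n {d d′} lv → n ≤ d → n ≤ d′ → frac P d lv n ≈ frac P d′ lv n
  frac-stable n = go n n ≤-refl
    where
    go : ∀ N n → n ≤ N → ∀ {d d′} lv → n ≤ d → n ≤ d′ → frac P d lv n ≈ frac P d′ lv n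
    go N zero _ {d} {d′} lv _ _ = ≈-trans (frac-zero d lv) (≈-sym (frac-zero d′ lv))
    go (suc N) (suc n) (s≤s n≤N) {suc d} {suc d′} lv (s≤s n≤d) (s≤s n≤d′) = begin
      frac P (suc d) lv (suc n)                              ≈⟨ inv-suc (coeff (frac P d) lv) n ⟩
      conv (coeff (frac P d) lv) (frac P (suc d) lv) n       ≈⟨ conv-cong n
          (λ k k≤n → ⊕-congˡ (⊗-congˡ (go N k (≤-trans k≤n n≤N) (suc lv) (≤-trans k≤n n≤d) (≤-trans k≤n n≤d′))))
          (λ k k≤n → go N k (≤-trans k≤n n≤N) lv (m≤n⇒m≤1+n (≤-trans k≤n n≤d)) (m≤n⇒m≤1+n (≤-trans k≤n n≤d′))) ⟩
      conv (coeff (frac P d′) lv) (frac P (suc d′) lv) n     ≈⟨ inv-suc (coeff (frac P d′) lv) n ⟨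
      frac P (suc d′) lv (suc n)                             ∎
      where open ≈-Reasoning

  -- The infinite fraction from level `lv` on, obtained as a diagonal: depth `n` already gives the
  -- exact coefficient of order `n`.
  F : ℕ → Series
  F lv n = frac P n lv n

  F-suc : ∀ lv n → F lv (suc n) ≈ conv (coeff F lv) (F lv) n
  F-suc lv n = ≈-trans (inv-suc (coeff (frac P n) lv) n) (conv-cong n
    (λ k k≤n → ⊕-congˡ (⊗-congˡ (frac-stable k (suc lv) k≤n ≤-refl)))
    (λ k k≤n → frac-stable k lv (m≤n⇒m≤1+n k≤n) ≤-refl))

  conv-F-zero : ∀ lv g → conv (F lv) g 0 ≈ g 0
  conv-F-zero lv g = ⊗-identityˡ (g 0)

  -- From this level on δ is zero, so F = 1 + α t F⁺ F with F⁺ the fraction one level further; this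
  -- is the equation multiplied by `g`. The two steps of the descent lemmas produce exactly its
  -- right-hand side.
  conv-F-suc : ∀ lv g n →
    conv (F (suc lv)) g (suc n) ≈ g (suc n) ⊕ α P (suc (suc lv)) ⊗ conv (F (suc (suc lv))) (conv (F (suc lv)) g) n
  conv-F-suc lv g n = ⊕-cong (⊗-identityˡ _) (begin
    conv (tail (F (suc lv))) g n                                      ≈⟨ conv-congˡ n (F-suc (suc lv)) ⟩
    conv (conv (coeff F (suc lv)) (F (suc lv))) g n                   ≈⟨ conv-assoc (coeff F (suc lv)) (F (suc lv)) g n ⟩
    conv (coeff F (suc lv)) (conv (F (suc lv)) g) n                   ≈⟨ conv-congˡ n (λ k → ≈-trans (⊕-congʳ (zeroˡ _)) (⊕-identityˡ _)) ⟩
    conv (scale (α P (suc (suc lv))) (F (suc (suc lv)))) (conv (F (suc lv)) g) n ≈⟨ conv-scaleˡ _ (F (suc (suc lv))) _ n ⟩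
    α P (suc (suc lv)) ⊗ conv (F (suc (suc lv))) (conv (F (suc lv)) g) n ∎)
    where open ≈-Reasoning

  α-even : ∀ h → α P (suc (suc (double h))) ≈ levelEven (suc h) ⊗ levelOdd (suc h)
  α-even h rewrite isEven-double h | half-suc-double h = ≈-refl

  α-odd : ∀ h → α P (suc (double h)) ≈ up h ⊗ down (suc h)
  α-odd h rewrite isEven-double h | half-double h = ≈-refl

  -- Generating functions of the paths from height h to 0 that start with an odd, resp. an even, step.
  fromOdd fromEven : ℕ → Series
  fromOdd h n = pathSum false (double n) h
  fromEven h n = pathSum true (suc (double n)) h

  -- Decomposition at the first descent, in doubled heights: a path from 2h + 1, respectively 2h +
  -- 2, makes an excursion that never goes below its start, counted by `F` at that level, then takes
  -- the down step and continues from one unit lower. The shift from `suc n` to `n` in the second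
  -- case arises because the odd down step completes a pair of positions with the odd number of
  -- steps after it.
  EvenDescent OddDescent : ℕ → ℕ → Set ℓ₂
  EvenDescent h n = fromEven (suc h) n ≈ down (suc h) ⊗ conv (F (suc (double h))) (fromOdd h) n
  OddDescent h n = fromOdd (suc h) (suc n) ≈ levelOdd (suc h) ⊗ conv (F (double (suc h))) (fromEven (suc h)) n

  -- An initial down step is the trivial excursion. After an initial up step, the path must descend
  -- back to its starting height, by the companion statement, and then descend once more, by
  -- induction on the order. The two step weights multiply to α, and `conv-F-suc` combines both
  -- alternatives.
  evenDescent : ∀ N n → n ≤ N → ∀ h → EvenDescent h n
  oddDescent : ∀ N n → n ≤ N → ∀ h → OddDescent h n

  evenDescent N zero _ h = begin
    levelEven (suc h) ⊗ 0# ⊕ down (suc h) ⊗ fromOdd h 0  ≈⟨ ≈-trans (⊕-congʳ (zeroʳ _)) (⊕-identityˡ _) ⟩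
    down (suc h) ⊗ fromOdd h 0                           ≈⟨ ⊗-congˡ (conv-F-zero (suc (double h)) (fromOdd h)) ⟨
    down (suc h) ⊗ conv (F (suc (double h))) (fromOdd h) 0 ∎
    where open ≈-Reasoning
  evenDescent (suc N) (suc n) (s≤s n≤N) h = begin
    levelEven (suc h) ⊗ fromOdd (suc h) (suc n) ⊕ D ⊗ fromOdd h (suc n)
      ≈⟨ ≈-trans (⊕-comm _ _) (⊕-congˡ (⊗-congˡ (oddDescent N n n≤N h))) ⟩
    D ⊗ fromOdd h (suc n) ⊕ levelEven (suc h) ⊗ (levelOdd (suc h) ⊗ conv (F (suc lv)) (fromEven (suc h)) n)
      ≈⟨ ⊕-congˡ (≈-trans (≈-sym (⊗-assoc _ _ _)) (⊗-cong (≈-sym (α-even h))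
           (conv-cong n (λ _ _ → ≈-refl) (λ k k≤n → evenDescent N k (≤-trans k≤n n≤N) h)))) ⟩
    D ⊗ fromOdd h (suc n) ⊕ α P (suc lv) ⊗ conv (F (suc lv)) (scale D G) n
      ≈⟨ ⊕-congˡ (≈-trans (⊗-congˡ (conv-scaleʳ D (F (suc lv)) G n)) (x⊗yz≈y⊗xz _ _ _)) ⟩
    D ⊗ fromOdd h (suc n) ⊕ D ⊗ (α P (suc lv) ⊗ conv (F (suc lv)) G n)
      ≈⟨ distribˡ _ _ _ ⟨
    D ⊗ (fromOdd h (suc n) ⊕ α P (suc lv) ⊗ conv (F (suc lv)) G n)
      ≈⟨ ⊗-congˡ (conv-F-suc (double h) (fromOdd h) n) ⟨
    D ⊗ conv (F lv) (fromOdd h) (suc n) ∎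
    where
    open ≈-Reasoning
    D = down (suc h)
    lv = suc (double h)
    G = conv (F lv) (fromOdd h)

  oddDescent N zero _ h = begin
    levelOdd (suc h) ⊗ fromEven (suc h) 0 ⊕ up (suc h) ⊗ fromEven (suc (suc h)) 0
      ≈⟨ ⊕-congˡ (≈-trans (⊗-congˡ (≈-trans (⊕-cong (zeroʳ _) (zeroʳ _)) (⊕-identityˡ 0#))) (zeroʳ _)) ⟩
    levelOdd (suc h) ⊗ fromEven (suc h) 0 ⊕ 0#
      ≈⟨ ⊕-identityʳ _ ⟩
    levelOdd (suc h) ⊗ fromEven (suc h) 0
      ≈⟨ ⊗-congˡ (conv-F-zero (double (suc h)) (fromEven (suc h))) ⟨
    levelOdd (suc h) ⊗ conv (F (double (suc h))) (fromEven (suc h)) 0 ∎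
    where open ≈-Reasoning
  oddDescent (suc N) (suc n) (s≤s n≤N) h = begin
    O ⊗ fromEven (suc h) (suc n) ⊕ up (suc h) ⊗ fromEven (suc (suc h)) (suc n)
      ≈⟨ ⊕-congˡ (⊗-congˡ (evenDescent (suc N) (suc n) (s≤s n≤N) (suc h))) ⟩
    O ⊗ fromEven (suc h) (suc n) ⊕ up (suc h) ⊗ (down (suc (suc h)) ⊗ conv (F (suc lv)) (fromOdd (suc h)) (suc n))
      ≈⟨ ⊕-congˡ (≈-trans (≈-sym (⊗-assoc _ _ _)) (⊗-cong (≈-sym (α-odd (suc h))) (≈-trans
           -- A path of no steps cannot come down from positive height, so the constant coefficient
           -- of `fromOdd (suc h)` is zero.
           (conv-tailʳ (F (suc lv)) (fromOdd (suc h)) n ≈-refl)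
           (conv-cong n (λ _ _ → ≈-refl) (λ k k≤n → oddDescent N k (≤-trans k≤n n≤N) h))))) ⟩
    O ⊗ fromEven (suc h) (suc n) ⊕ α P (suc lv) ⊗ conv (F (suc lv)) (scale O G) n
      ≈⟨ ⊕-congˡ (≈-trans (⊗-congˡ (conv-scaleʳ O (F (suc lv)) G n)) (x⊗yz≈y⊗xz _ _ _)) ⟩
    O ⊗ fromEven (suc h) (suc n) ⊕ O ⊗ (α P (suc lv) ⊗ conv (F (suc lv)) G n)
      ≈⟨ distribˡ _ _ _ ⟨
    O ⊗ (fromEven (suc h) (suc n) ⊕ α P (suc lv) ⊗ conv (F (suc lv)) G n)
      ≈⟨ ⊗-congˡ (conv-F-suc (suc (double h)) (fromEven (suc h)) n) ⟨
    O ⊗ conv (F lv) (fromEven (suc h)) (suc n) ∎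
    where
    open ≈-Reasoning
    O = levelOdd (suc h)
    lv = double (suc h)
    G = conv (F lv) (fromEven (suc h))

  -- At height 0 neither a double rise nor a double fall is available, and both fixed points are
  -- record-antirecords.
  δ-level : δ P 1 ≈ levelOdd 0 ⊗ levelEven 0
  δ-level = begin
    λ' ⊗ λ' ⊗ zₑ ⊗ zₒ                ≈⟨ ⊗-assoc _ _ _ ⟩
    λ' ⊗ λ' ⊗ (zₑ ⊗ zₒ)              ≈⟨ ⊗-congˡ (⊗-comm _ _) ⟩
    λ' ⊗ λ' ⊗ (zₒ ⊗ zₑ)              ≈⟨ ⊗-interchange _ _ _ _ ⟩
    λ' ⊗ zₒ ⊗ (λ' ⊗ zₑ)              ≈⟨ ⊗-cong (⊕-identityˡ _) (⊕-identityˡ _) ⟨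
    levelOdd 0 ⊗ levelEven 0         ∎
    where open ≈-Reasoning

  -- From height 0 a path either makes the excursion to doubled height -1, giving δ₁, or goes up
  -- through a valley, after which `evenDescent` at height 0 supplies α₁ and the fraction of the
  -- next level.
  F≈fromOdd : ∀ N n → n ≤ N → F 0 n ≈ fromOdd 0 n
  F≈fromOdd N zero _ = ≈-refl
  F≈fromOdd (suc N) (suc n) (s≤s n≤N) = begin
    F 0 (suc n)
      ≈⟨ F-suc 0 n ⟩
    conv (coeff F 0) (F 0) n
      ≈⟨ conv-cong n (λ _ _ → ≈-refl) (λ k k≤n → F≈fromOdd N k (≤-trans k≤n n≤N)) ⟩
    conv (coeff F 0) A n
      ≈⟨ conv-⊕ˡ (scale (δ P 1) oneS) (scale (α P 1) (F 1)) A n ⟩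
    conv (scale (δ P 1) oneS) A n ⊕ conv (scale (α P 1) (F 1)) A n
      ≈⟨ ⊕-cong (≈-trans (conv-scaleˡ (δ P 1) oneS A n) (⊗-congˡ (conv-oneˡ A n))) (conv-scaleˡ (α P 1) (F 1) A n) ⟩
    δ P 1 ⊗ A n ⊕ α P 1 ⊗ conv (F 1) A n
      ≈⟨ ⊕-cong (≈-trans (⊗-congʳ δ-level) (⊗-assoc _ _ _)) (≈-trans (⊗-congʳ (α-odd 0)) (⊗-assoc _ _ _)) ⟩
    levelOdd 0 ⊗ (levelEven 0 ⊗ A n) ⊕ up 0 ⊗ (down 1 ⊗ conv (F 1) A n)
      -- After an odd fixed point at height 0 no peak can follow, as `down 0` is zero; this forces
      -- the return.
      ≈⟨ ⊕-cong (⊗-congˡ (≈-sym (≈-trans (⊕-congˡ (zeroˡ _)) (⊕-identityʳ _)))) (⊗-congˡ (≈-sym (evenDescent n n ≤-refl 0))) ⟩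
    fromOdd 0 (suc n) ∎
    where
    open ≈-Reasoning
    A = fromOdd 0

  frac≈pathSum : ∀ n N → n ≤ N → frac P N 0 n ≈ pathSum false (n + n) 0
  frac≈pathSum n N n≤N = ≈-trans (frac-stable n 0 n≤N ≤-refl) (≈-trans (F≈fromOdd n n ≤-refl)
    (≈-reflexive (cong (λ r → pathSum false r 0) (double≡+ n))))

theorem4p3 : ∀ {c ℓ : Level} (R : CommutativeRing c ℓ) (P : WithRing.Params R) →
    CommutativeRing._≈_ R (WithRing.Params.v₁ P) (WithRing.Params.y₁ P) →
    CommutativeRing._≈_ R (WithRing.Params.q₊₁ P) (WithRing.Params.p₊₁ P) →
    ∀ (n N : ℕ) → n ≤ N →
    CommutativeRing._≈_ R (WithRing.frac R P N 0 n) (WithRing.Phat R P n)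
theorem4p3 R P v₁≈y₁ q₊₁≈p₊₁ n N n≤N = CommutativeRing.trans R
  (ContinuedFraction.frac≈pathSum R P n N n≤N)
  (CommutativeRing.sym R (PathSums.Phat≈pathSum R P v₁≈y₁ q₊₁≈p₊₁ n))
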